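{- Let $P$ be a poset which is Gorenstein$^\ast$ over $\mathbb{Z}_2$, and let $\nu$ be an automorphism of $P$ with $\nu^2=\mathrm{id}$. Then the subposet of $P$ induced by the set of fixed points of $\nu$ is Gorenstein$^\ast$ over $\mathbb{Z}_2$.
   Context: A poset is bounded if it has a unique minimum $\hat 0$ and maximum $\hat 1$. For a bounded poset or interval, topological properties refer to the order complex (simplicial complex of chains) of its proper part (the poset with $\hat 0,\hat 1$ removed). A poset $P$ is Gorenstein$^\ast$ over $\mathbb{Z}_2$ if it is bounded, graded and finite, and every interval $[p,q]\subseteq P$ is a homology sphere over $\mathbb{Z}_2$ of top dimension, i.e. the order complex of the open interval $(p,q)$ has reduced homology with $\mathbb{Z}_2$ coefficients isomorphic to $\mathbb{Z}_2$ in degree $\rho(q)-\rho(p)-2$ and zero in all other degrees, where $\rho$ is the rank function. -}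

module Defs where

open import Level using (0ℓ)
open import Data.Nat using (ℕ; zero; suc; _∸_)
open import Data.Bool using (Bool; true; false; _xor_; if_then_else_)
open import Data.Fin using (Fin)
open import Data.Fin.Subset using (Subset; _∈_; _∉_; _∪_; ⁅_⁆; ∣_∣)
open import Data.Fin.Subset.Properties using (_∈?_)
open import Data.Vec using (allFin; foldr′)
import Data.Vec as Vec
open import Data.Product using (Σ; ∃; _×_)
open import Data.Sum using (_⊎_)
open import Relation.Nullary using (¬_; yes; no)
open import Relation.Unary using (Pred)
open import Relation.Binary using (Rel; IsPartialOrder)
open import Relation.Binary.PropositionalEquality using (_≡_; _≢_)
open import Function.Bundles using (_⇔_)

record FinPoset (n : ℕ) : Set₁ where
  field
    _≤_            : Rel (Fin n) 0ℓ
    isPartialOrder : IsPartialOrder _≡_ _≤_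

module _ {n : ℕ} (P : FinPoset n) where
  open FinPoset P

  _<_ : Rel (Fin n) 0ℓ
  x < y = (x ≤ y) × (x ≢ y)

  -- Order complex of the subposet induced by Q ⊆ Fin n, with reduced
  -- simplicial chain complex over ℤ₂.  A face is a chain, represented as
  -- a subset of Fin n; a face with m elements has dimension m - 1 (the
  -- empty chain, m = 0, is the (-1)-dimensional face of the reduced
  -- complex).  A ℤ₂-chain is a function Subset n → Bool.

  IsChainIn : Pred (Fin n) 0ℓ → Subset n → Set
  IsChainIn Q σ = (∀ x → x ∈ σ → Q x) × (∀ x y → x ∈ σ → y ∈ σ → (x ≤ y) ⊎ (y ≤ x))

  Supported : Pred (Fin n) 0ℓ → ℕ → (Subset n → Bool) → Set
  Supported Q m c = ∀ σ → c σ ≡ true → IsChainIn Q σ × (∣ σ ∣ ≡ m)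

  ∂ : (Subset n → Bool) → (Subset n → Bool)
  ∂ c σ = foldr′ _xor_ false
            (Vec.map (λ x → if does (x ∈? σ) then false else c (σ ∪ ⁅ x ⁆)) (allFin n))
    where open Relation.Nullary using (does)

  Cycle : Pred (Fin n) 0ℓ → ℕ → (Subset n → Bool) → Set
  Cycle Q m c = Supported Q m c × (∀ σ → ∂ c σ ≡ false)

  Boundary : Pred (Fin n) 0ℓ → ℕ → (Subset n → Bool) → Set
  Boundary Q m c = ∃ λ b → Supported Q (suc m) b × (∀ σ → ∂ b σ ≡ c σ)

  _⊕_ : (Subset n → Bool) → (Subset n → Bool) → (Subset n → Bool)
  (c ⊕ d) σ = c σ xor d σ

  -- reduced homology (faces with m elements, i.e. degree m - 1) vanishes
  HomologyZero : Pred (Fin n) 0ℓ → ℕ → Set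
  HomologyZero Q m = ∀ c → Cycle Q m c → Boundary Q m c

  -- reduced homology (in degree m - 1) is ≅ ℤ₂: generated by one
  -- non-trivial class
  Homologyℤ₂ : Pred (Fin n) 0ℓ → ℕ → Set
  Homologyℤ₂ Q m = ∃ λ z → Cycle Q m z × ¬ Boundary Q m z
                     × (∀ c → Cycle Q m c → Boundary Q m c ⊎ Boundary Q m (c ⊕ z))

  -- ℤ₂-homology sphere of dimension d - 1 (faces with d elements)
  HomologySphere : Pred (Fin n) 0ℓ → ℕ → Set
  HomologySphere Q d = Homologyℤ₂ Q d × (∀ m → m ≢ d → HomologyZero Q m)

  CoversIn : Pred (Fin n) 0ℓ → Fin n → Fin n → Set
  CoversIn S x y = (x < y) × (∀ z → S z → x < z → ¬ (z < y))

  OpenInterval : Pred (Fin n) 0ℓ → Fin n → Fin n → Pred (Fin n) 0ℓ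
  OpenInterval S p q z = S z × (p < z) × (z < q)

  -- Gorenstein* over ℤ₂: bounded, graded (with rank function ρ,
  -- ρ(0̂) = 0, ρ increasing by 1 along covers), and for every p < q in S
  -- the open interval (p,q) is a ℤ₂-homology sphere of dimension
  -- ρ(q) - ρ(p) - 2, i.e. with top faces having ρ(q) - ρ(p) - 1 elements.
  GorensteinOn : Pred (Fin n) 0ℓ → Set
  GorensteinOn S =
    Σ (Fin n) λ 0̂ → Σ (Fin n) λ 1̂ →
      S 0̂ × S 1̂ × (∀ x → S x → (0̂ ≤ x) × (x ≤ 1̂)) ×
      Σ (Fin n → ℕ) λ ρ →
        (ρ 0̂ ≡ 0) ×
        (∀ x y → S x → S y → CoversIn S x y → ρ y ≡ suc (ρ x)) ×
        (∀ p q → S p → S q → p < q →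
           HomologySphere (OpenInterval S p q) (ρ q ∸ ρ p ∸ 1))

open import Data.Unit using (⊤)

Gorenstein* : {n : ℕ} → FinPoset n → Set
Gorenstein* P = GorensteinOn P (λ _ → ⊤)

-- order automorphism (bijectivity follows from ν ∘ ν = id below)
IsOrderAutomorphism : {n : ℕ} → FinPoset n → (Fin n → Fin n) → Set
IsOrderAutomorphism P ν = ∀ x y → (x ≤ y) ⇔ (ν x ≤ ν y)
  where open FinPoset P

FixedPoints : {n : ℕ} → (Fin n → Fin n) → Pred (Fin n) 0ℓ
FixedPoints ν x = ν x ≡ x

{-# OPTIONS --safe #-}

-- Every open interval (p,q) of the fixed-point poset consists of the ν-fixed points of the
-- corresponding interval of P, so Smith theory makes it a ℤ₂-homology sphere of some dimension.
-- With τ = 1 + ν, the invariant chains split as τC ⊕ C(Fix), and the exact sequence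
-- 0 → C^ν → C → τC → 0 gives an isomorphism H(C^ν) ≅ H(τC) with a shift of degree by one, except
-- around the top degree d of C.  So every class of Fix below degree d can be lifted step by step
-- to a class of degree d: distinct classes of Fix stay independent in H_d(C) = ℤ₂, and they cannot
-- all vanish since otherwise the fundamental class would bound.
--
-- It remains to see that the dimensions come from a rank function.  If all open intervals of a
-- finite poset are spheres, then every maximal chain of (p,q) has as many elements as the
-- dimension of the sphere prescribes: by induction on intervals, the sum of all maximal chains of
-- a given size is a cycle, and it does not bound.  Concatenating maximal chains then
-- shows that dimensions are additive.

module Submission where

open import Defs
open import Level using (0ℓ)
open import Algebra.Bundles using (CommutativeRing)
import Algebra.Properties.CommutativeMonoid.Sum as CMSum
open import Data.Bool using (Bool; true; false; _xor_; _∧_; if_then_else_)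
import Data.Bool as Bool
open import Data.Bool.Properties using (xor-∧-commutativeRing; xor-same; xor-identityʳ; xor-comm; ∧-identityʳ; ∧-zeroʳ; ∧-distribʳ-xor)
open import Data.Bool.Solver using (module xor-∧-Solver)
open import Data.Empty using (⊥-elim)
open import Data.Fin using (Fin; zero; suc)
import Data.Fin.Properties as Fin
open import Data.Fin.Induction using (po-wellFounded; po-noetherian)
open import Data.Fin.Permutation using (permutation)
open import Data.Fin.Subset using (Subset; _∈_; _∉_; _∪_; ⁅_⁆; ∣_∣; inside; outside; Nonempty)
import Data.Fin.Subset as Subset
open import Data.Fin.Subset.Properties using (_∈?_; x∈⁅x⁆; x∈⁅y⁆⇒x≡y; x∈p∪q⁻; p⊆p∪q; q⊆p∪q; p⊆q⇒∣p∣≤∣q∣; ⊆-antisym; ∪-comm; ∪-assoc; ∪-identityˡ; ∪-identityʳ; ∣p∣≤n; ∣⊥∣≡0; ∣⁅x⁆∣≡1; ∉⊥; Empty-unique; anySubset?; nonempty?)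
open import Data.Nat as ℕ using (ℕ; zero; suc)
import Data.Nat.Properties as ℕ
open import Data.Product using (∃; _×_; _,_; proj₁; proj₂)
open import Data.Sum as Sum using (_⊎_; inj₁; inj₂; [_,_]′)
open import Data.Unit using (⊤; tt)
open import Data.Vec using ([]; _∷_; here; there; foldr′; lookup; tabulate)
open import Data.Vec.Properties using (tabulate-∘; lookup∘tabulate; lookup⇒[]=; []=⇒lookup)
open import Effect.Monad using (RawMonad)
open import Function using (id; _∘_; const; flip)
open import Function.Bundles using (Equivalence)
open import Induction.WellFounded using (Acc; acc)
open import Relation.Binary using (IsPartialOrder; Rel)
open import Relation.Binary.Definitions using (tri<; tri≈; tri>)
open import Relation.Binary.PropositionalEquality hiding (isPartialOrder)
open import Relation.Nullary using (¬_; Dec; does; yes; no; contradiction; _×-dec_; _⊎-dec_; _→-dec_; ¬?)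
open import Relation.Nullary.Decidable using (decidable-stable; dec-true; map′; ¬¬-excluded-middle)
open import Relation.Nullary.Negation using (¬¬-Monad; ¬¬-map)
open import Relation.Unary using (Pred; Decidable)

open xor-∧-Solver using (solve; _:+_; _:=_; con)
open CMSum (CommutativeRing.+-commutativeMonoid xor-∧-commutativeRing)
  using (sum; sum-cong-≗; ∑-distrib-+; sum-permute; sum-replicate-zero)
private
  module Σℕ = CMSum ℕ.+-0-commutativeMonoid
  variable
    n : ℕ

-- Simplicial chains over ℤ₂

-- Over ℤ₂ every off-diagonal entry cancels against its mirror image; the induction strips the first
-- row together with the first column. This is the cancellation behind `δδ`.
sum-symmetric : (g : Fin n → Fin n → Bool) → (∀ x y → g x y ≡ g y x) →
  (∀ x → g x x ≡ false) → sum (λ x → sum (g x)) ≡ false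
sum-symmetric {zero}  g sym-g diag = refl
sum-symmetric {suc n} g sym-g diag = begin
  (g zero zero xor row) xor sum (λ x → g (suc x) zero xor sum (λ y → g (suc x) (suc y)))
    ≡⟨ cong₂ (λ u v → (u xor row) xor v) (diag zero)
         (∑-distrib-+ (λ x → g (suc x) zero) (λ x → sum (λ y → g (suc x) (suc y)))) ⟩
  row xor (sum (λ x → g (suc x) zero) xor sum (λ x → sum (λ y → g (suc x) (suc y))))
    ≡⟨ cong₂ (λ u v → row xor (u xor v)) (sum-cong-≗ (λ x → sym-g (suc x) zero))
         (sum-symmetric (λ x y → g (suc x) (suc y)) (λ x y → sym-g (suc x) (suc y)) (λ x → diag (suc x))) ⟩
  row xor (row xor false)
    ≡⟨ solve 1 (λ r → r :+ (r :+ con false) := con false) refl row ⟩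
  false ∎
  where
  open ≡-Reasoning
  row = sum (λ y → g zero (suc y))

sum-true : (f : Fin n → Bool) → sum f ≡ true → ∃ λ x → f x ≡ true
sum-true {suc n} f eq with f zero in f0
... | true  = zero , f0
... | false with sum-true (f ∘ suc) eq
...   | x , fx = suc x , fx

sum-zero : (f : Fin n → Bool) → (∀ x → f x ≡ false) → sum f ≡ false
sum-zero {n} f f≗0 = trans (sum-cong-≗ f≗0) (sum-replicate-zero n)

sum-unique : (f : Fin n → Bool) (x : Fin n) → f x ≡ true →
  (∀ y → f y ≡ true → y ≡ x) → sum f ≡ true
sum-unique f zero fx unique = cong₂ _xor_ fx (sum-zero _ others)
  where
  others : ∀ y → f (suc y) ≡ false
  others y with f (suc y) in eq
  ... | false = refl
  ... | true with () ← unique (suc y) eq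
sum-unique f (suc x) fx unique = cong₂ _xor_ head (sum-unique (f ∘ suc) x fx tail)
  where
  head : f zero ≡ false
  head with f zero in eq
  ... | false = refl
  ... | true with () ← unique zero eq
  tail : ∀ y → f (suc y) ≡ true → y ≡ x
  tail y eq with unique (suc y) eq
  ... | refl = refl

sum-involution : (ν : Fin n → Fin n) → (∀ x → ν (ν x) ≡ x) → (f : Fin n → Bool) →
  sum (f ∘ ν) ≡ sum f
sum-involution ν νν f = sym (sum-permute f (permutation ν ν νν νν))

-- Adjoining a point to a subset

x∈σ∪x : (σ : Subset n) (x : Fin n) → x ∈ σ ∪ ⁅ x ⁆
x∈σ∪x σ x = q⊆p∪q σ ⁅ x ⁆ (x∈⁅x⁆ x)

∈-∪⁅⁆ : (σ : Subset n) (x : Fin n) {y : Fin n} → y ∈ σ ∪ ⁅ x ⁆ → y ∈ σ ⊎ y ≡ x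
∈-∪⁅⁆ σ x y∈ with x∈p∪q⁻ σ ⁅ x ⁆ y∈
... | inj₁ y∈σ = inj₁ y∈σ
... | inj₂ y∈x = inj₂ (x∈⁅y⁆⇒x≡y x y∈x)

subset-ext : {σ τ : Subset n} → (∀ x → x ∈ σ → x ∈ τ) → (∀ x → x ∈ τ → x ∈ σ) → σ ≡ τ
subset-ext σ⊆τ τ⊆σ = ⊆-antisym (λ {x} → σ⊆τ x) (λ {x} → τ⊆σ x)

∣σ∪x∣ : (σ : Subset n) (x : Fin n) → x ∉ σ → ∣ σ ∪ ⁅ x ⁆ ∣ ≡ suc ∣ σ ∣
∣σ∪x∣ (inside ∷ σ)  zero    x∉ = ⊥-elim (x∉ here)
∣σ∪x∣ (outside ∷ σ) zero    x∉ = cong (suc ∘ ∣_∣) (∪-identityʳ σ)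
∣σ∪x∣ (inside ∷ σ)  (suc x) x∉ = cong suc (∣σ∪x∣ σ x (x∉ ∘ there))
∣σ∪x∣ (outside ∷ σ) (suc x) x∉ = ∣σ∪x∣ σ x (x∉ ∘ there)

∈⇒∣∣≢0 : {σ : Subset n} {x : Fin n} → x ∈ σ → ∣ σ ∣ ≢ 0
∈⇒∣∣≢0 {σ = inside ∷ σ}  _          ()
∈⇒∣∣≢0 {σ = outside ∷ σ} (there x∈) eq = ∈⇒∣∣≢0 x∈ eq

-- As a sum over all points, the cardinality can be reindexed along `ν`, which gives `∣νs∣`.
∣_∣≡Σ : (σ : Subset n) → ∣ σ ∣ ≡ Σℕ.sum (λ x → if lookup σ x then 1 else 0)
∣ [] ∣≡Σ          = refl
∣ inside ∷ σ ∣≡Σ  = cong suc ∣ σ ∣≡Σ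
∣ outside ∷ σ ∣≡Σ = ∣ σ ∣≡Σ

Chain : ℕ → Set
Chain n = Subset n → Bool

face : Chain n → Subset n → Fin n → Bool
face c σ x = if does (x ∈? σ) then false else c (σ ∪ ⁅ x ⁆)

face-true : (c : Chain n) {σ : Subset n} {x : Fin n} → face c σ x ≡ true →
  x ∉ σ × c (σ ∪ ⁅ x ⁆) ≡ true
face-true c {σ} {x} eq with x ∈? σ
... | no x∉σ = x∉σ , eq

face-∉ : (c : Chain n) {σ : Subset n} {x : Fin n} → x ∉ σ → face c σ x ≡ c (σ ∪ ⁅ x ⁆)
face-∉ c {σ} {x} x∉σ with x ∈? σ
... | yes x∈σ = contradiction x∈σ x∉σ
... | no _    = refl

face-∈ : (c : Chain n) {σ : Subset n} {x : Fin n} → x ∈ σ → face c σ x ≡ false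
face-∈ c {σ} {x} x∈σ with x ∈? σ
... | yes _   = refl
... | no x∉σ = contradiction x∈σ x∉σ

module Complex (P : FinPoset n) where
  open FinPoset P

  infixl 6 _+_
  _+_ : Chain n → Chain n → Chain n
  _+_ = _⊕_ P

  δ : Chain n → Chain n
  δ = ∂ P

  0c : Chain n
  0c _ = false

  δ-sum : ∀ c σ → δ c σ ≡ sum (face c σ)
  δ-sum c σ = trans (cong (foldr′ _xor_ false) (sym (tabulate-∘ (face c σ) id))) (fold-tabulate (face c σ))
    where
    fold-tabulate : ∀ {m} (f : Fin m → Bool) → foldr′ _xor_ false (tabulate f) ≡ sum f
    fold-tabulate {zero}  f = refl
    fold-tabulate {suc m} f = cong (f zero xor_) (fold-tabulate (f ∘ suc))

  δ-true : ∀ {c σ} → δ c σ ≡ true → ∃ λ x → x ∉ σ × c (σ ∪ ⁅ x ⁆) ≡ true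
  δ-true {c} {σ} eq with sum-true (face c σ) (trans (sym (δ-sum c σ)) eq)
  ... | x , fx = x , face-true c fx

  δ-cong : ∀ {c d} → c ≗ d → δ c ≗ δ d
  δ-cong {c} {d} c≗d σ = trans (δ-sum c σ) (trans (sum-cong-≗ faces) (sym (δ-sum d σ)))
    where
    faces : face c σ ≗ face d σ
    faces x with x ∈? σ
    ... | yes _ = refl
    ... | no _  = c≗d _

  δ-+ : ∀ c d → δ (c + d) ≗ δ c + δ d
  δ-+ c d σ = begin
    δ (c + d) σ                            ≡⟨ δ-sum (c + d) σ ⟩
    sum (face (c + d) σ)                   ≡⟨ sum-cong-≗ faces ⟩
    sum (λ x → face c σ x xor face d σ x)  ≡⟨ ∑-distrib-+ (face c σ) (face d σ) ⟩
    sum (face c σ) xor sum (face d σ)      ≡⟨ cong₂ _xor_ (δ-sum c σ) (δ-sum d σ) ⟨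
    (δ c + δ d) σ                          ∎
    where
    open ≡-Reasoning
    faces : ∀ x → face (c + d) σ x ≡ face c σ x xor face d σ x
    faces x with x ∈? σ
    ... | yes _ = refl
    ... | no _  = refl

  δ-0 : δ 0c ≗ 0c
  δ-0 σ with δ 0c σ in eq
  ... | false = refl
  ... | true with _ , _ , () ← δ-true {0c} eq

  δδ : ∀ c → δ (δ c) ≗ 0c
  δδ c σ = trans (δ-sum (δ c) σ) (trans (sum-cong-≗ faces) (sum-symmetric g g-sym g-diag))
    where
    -- `g x y` is the contribution of adjoining first `x` and then `y`; the resulting face does not
    -- depend on the order.
    g : Fin n → Fin n → Bool
    g x y = if does (x ∈? σ) then false else face c (σ ∪ ⁅ x ⁆) y

    faces : ∀ x → face (δ c) σ x ≡ sum (g x)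
    faces x with x ∈? σ
    ... | yes _ = sym (sum-zero {n} (const false) (λ _ → refl))
    ... | no _  = δ-sum c _

    g-diag : ∀ x → g x x ≡ false
    g-diag x with x ∈? σ
    ... | yes _ = refl
    ... | no _  = face-∈ c (x∈σ∪x σ x)

    g-⊆ : ∀ x y → g x y ≡ true → g y x ≡ true
    g-⊆ x y eq with x ∈? σ
    ... | no x∉σ with face-true c eq
    ...   | y∉σx , cσxy with y ∈? σ
    ...     | yes y∈σ = contradiction (p⊆p∪q ⁅ x ⁆ y∈σ) y∉σx
    ...     | no y∉σ = trans (face-∉ c x∉σy) (trans (cong c swap) cσxy)
      where
      x∉σy : x ∉ σ ∪ ⁅ y ⁆
      x∉σy x∈ with ∈-∪⁅⁆ σ y x∈
      ... | inj₁ x∈σ = x∉σ x∈σ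
      ... | inj₂ refl = y∉σx (x∈σ∪x σ x)
      swap : (σ ∪ ⁅ y ⁆) ∪ ⁅ x ⁆ ≡ (σ ∪ ⁅ x ⁆) ∪ ⁅ y ⁆
      swap = trans (∪-assoc σ _ _) (trans (cong (σ ∪_) (∪-comm ⁅ y ⁆ ⁅ x ⁆)) (sym (∪-assoc σ _ _)))

    g-sym : ∀ x y → g x y ≡ g y x
    g-sym x y with g x y in xy | g y x in yx
    ... | true  | true  = refl
    ... | false | false = refl
    ... | true  | false = trans (sym (g-⊆ x y xy)) yx
    ... | false | true  = trans (sym xy) (g-⊆ y x yx)

  +-true : ∀ c d {σ} → (c + d) σ ≡ true → c σ ≡ true ⊎ d σ ≡ true
  +-true c d {σ} eq with c σ
  ... | true  = inj₁ refl
  ... | false = inj₂ eq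

  module _ {Q : Fin n → Set} where

    ⊆-chain : ∀ {σ τ} → (∀ x → x ∈ σ → x ∈ τ) → IsChainIn P Q τ → IsChainIn P Q σ
    ⊆-chain σ⊆τ (τ⊆Q , τ-total) =
      (λ x x∈ → τ⊆Q x (σ⊆τ x x∈)) , λ x y x∈ y∈ → τ-total x y (σ⊆τ x x∈) (σ⊆τ y y∈)

    supp-+ : ∀ {m c d} → Supported P Q m c → Supported P Q m d → Supported P Q m (c + d)
    supp-+ {c = c} {d} C D σ eq with +-true c d eq
    ... | inj₁ cσ = C σ cσ
    ... | inj₂ dσ = D σ dσ

    supp-0 : ∀ {m} → Supported P Q m 0c
    supp-0 σ ()

    supp-δ : ∀ {m c} → Supported P Q (suc m) c → Supported P Q m (δ c)
    supp-δ {c = c} C σ eq with δ-true {c} eq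
    ... | x , x∉σ , cσx with C _ cσx
    ...   | chain , card = ⊆-chain (λ y → p⊆p∪q ⁅ x ⁆) chain , ℕ.suc-injective (trans (sym (∣σ∪x∣ σ x x∉σ)) card)

-- Smith theory of an involution

eqᵇ : Subset n → Subset n → Bool
eqᵇ []      []      = true
eqᵇ (x ∷ σ) (y ∷ τ) = if x xor y then false else eqᵇ σ τ

-- The strict lexicographic order with `outside` before `inside`.
lexᵇ : Subset n → Subset n → Bool
lexᵇ []      []      = false
lexᵇ (x ∷ σ) (y ∷ τ) = if x xor y then y else lexᵇ σ τ

eqᵇ-refl : (σ : Subset n) → eqᵇ σ σ ≡ true
eqᵇ-refl []            = refl
eqᵇ-refl (inside ∷ σ)  = eqᵇ-refl σ
eqᵇ-refl (outside ∷ σ) = eqᵇ-refl σ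

eqᵇ⇒≡ : (σ τ : Subset n) → eqᵇ σ τ ≡ true → σ ≡ τ
eqᵇ⇒≡ []            []            _  = refl
eqᵇ⇒≡ (inside ∷ σ)  (inside ∷ τ)  eq = cong (inside ∷_) (eqᵇ⇒≡ σ τ eq)
eqᵇ⇒≡ (outside ∷ σ) (outside ∷ τ) eq = cong (outside ∷_) (eqᵇ⇒≡ σ τ eq)

-- Trichotomy written as a sum over ℤ₂, the form in which it enters the identity `u ≗ τ a + π u`.
lexᵇ-trichotomous : (σ τ : Subset n) → (lexᵇ σ τ xor lexᵇ τ σ) xor eqᵇ τ σ ≡ true
lexᵇ-trichotomous []            []            = refl
lexᵇ-trichotomous (inside ∷ σ)  (inside ∷ τ)  = lexᵇ-trichotomous σ τ
lexᵇ-trichotomous (outside ∷ σ) (outside ∷ τ) = lexᵇ-trichotomous σ τ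
lexᵇ-trichotomous (inside ∷ σ)  (outside ∷ τ) = refl
lexᵇ-trichotomous (outside ∷ σ) (inside ∷ τ)  = refl

xor≡false⇒≡ : ∀ {x y} → x xor y ≡ false → x ≡ y
xor≡false⇒≡ {false} eq = sym eq
xor≡false⇒≡ {true} {true} eq = refl

-- `Q` will be an open interval of `P`, and `G` the same interval in the fixed-point poset. The
-- implications say that `G` is the set of fixed points of `Q`, to which it is not definitionally
-- equal.
module Smith {n} (P : FinPoset n) (ν : Fin n → Fin n)
  (aut : IsOrderAutomorphism P ν) (νν : ∀ x → ν (ν x) ≡ x)
  (Q G : Fin n → Set) (Q-ν : ∀ {x} → Q x → Q (ν x))
  (G⇒Q : ∀ {x} → G x → Q x) (G⇒fixed : ∀ {x} → G x → ν x ≡ x)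
  (fixed⇒G : ∀ {x} → ν x ≡ x → Q x → G x)
  where

  open FinPoset P
  open IsPartialOrder isPartialOrder using (antisym)
  open Complex P

  private
    C D : ℕ → Chain n → Set
    C = Supported P Q
    D = Supported P G

  -- The action of the involution on faces and chains

  νs : Subset n → Subset n
  νs σ = tabulate (lookup σ ∘ ν)

  ∈-νs⁻ : ∀ {σ x} → x ∈ νs σ → ν x ∈ σ
  ∈-νs⁻ {σ} {x} x∈ = lookup⇒[]= (ν x) σ (trans (sym (lookup∘tabulate (lookup σ ∘ ν) x)) ([]=⇒lookup x∈))

  ∈-νs⁺ : ∀ {σ x} → ν x ∈ σ → x ∈ νs σ
  ∈-νs⁺ {σ} {x} νx∈ = lookup⇒[]= x (νs σ) (trans (lookup∘tabulate (lookup σ ∘ ν) x) ([]=⇒lookup νx∈))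

  ν-∈ : ∀ {σ x} → x ∈ σ → ν x ∈ νs σ
  ν-∈ {σ} {x} x∈ = ∈-νs⁺ (subst (_∈ σ) (sym (νν x)) x∈)

  νsνs : ∀ σ → νs (νs σ) ≡ σ
  νsνs σ = subset-ext
    (λ x x∈ → subst (_∈ σ) (νν x) (∈-νs⁻ (∈-νs⁻ x∈)))
    (λ x x∈ → ∈-νs⁺ (ν-∈ x∈))

  νs-∪ : ∀ σ x → νs (σ ∪ ⁅ x ⁆) ≡ νs σ ∪ ⁅ ν x ⁆
  νs-∪ σ x = subset-ext to from
    where
    to : ∀ y → y ∈ νs (σ ∪ ⁅ x ⁆) → y ∈ νs σ ∪ ⁅ ν x ⁆
    to y y∈ with ∈-∪⁅⁆ σ x (∈-νs⁻ {σ ∪ ⁅ x ⁆} y∈)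
    ... | inj₁ νy∈σ = p⊆p∪q ⁅ ν x ⁆ (∈-νs⁺ νy∈σ)
    ... | inj₂ refl = subst (λ z → z ∈ νs σ ∪ ⁅ ν (ν y) ⁆) (νν y) (x∈σ∪x (νs σ) (ν (ν y)))
    from : ∀ y → y ∈ νs σ ∪ ⁅ ν x ⁆ → y ∈ νs (σ ∪ ⁅ x ⁆)
    from y y∈ with ∈-∪⁅⁆ (νs σ) (ν x) y∈
    ... | inj₁ y∈νσ = ∈-νs⁺ {σ ∪ ⁅ x ⁆} (p⊆p∪q ⁅ x ⁆ (∈-νs⁻ {σ} y∈νσ))
    ... | inj₂ refl = ν-∈ (x∈σ∪x σ x)

  ∣νs∣ : ∀ σ → ∣ νs σ ∣ ≡ ∣ σ ∣
  ∣νs∣ σ = begin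
    ∣ νs σ ∣                                       ≡⟨ ∣ νs σ ∣≡Σ ⟩
    Σℕ.sum (λ x → if lookup (νs σ) x then 1 else 0) ≡⟨ Σℕ.sum-cong-≗ (λ x → cong (if_then 1 else 0) (lookup∘tabulate (lookup σ ∘ ν) x)) ⟩
    Σℕ.sum (λ x → if lookup σ (ν x) then 1 else 0) ≡⟨ Σℕ.sum-permute (λ x → if lookup σ x then 1 else 0) (permutation ν ν νν νν) ⟨
    Σℕ.sum (λ x → if lookup σ x then 1 else 0)     ≡⟨ ∣ σ ∣≡Σ ⟨
    ∣ σ ∣                                          ∎
    where open ≡-Reasoning

  ν-chain : ∀ {σ} → IsChainIn P Q (νs σ) → IsChainIn P Q σ
  ν-chain {σ} (νσ⊆Q , νσ-total) =
    (λ x x∈ → subst Q (νν x) (Q-ν (νσ⊆Q (ν x) (ν-∈ x∈)))) ,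
    λ x y x∈ y∈ → [ inj₁ ∘ from (aut x y) , inj₂ ∘ from (aut y x) ]′ (νσ-total (ν x) (ν y) (ν-∈ x∈) (ν-∈ y∈))
    where open Equivalence

  -- The points `x` and `ν x` are comparable, and applying `ν` reverses their comparison, so
  -- antisymmetry identifies them.
  fixed-chain : ∀ {σ} → IsChainIn P Q σ → νs σ ≡ σ → ∀ x → x ∈ σ → ν x ≡ x
  fixed-chain {σ} (_ , total) νσ≡σ x x∈
    with total x (ν x) x∈ (∈-νs⁻ (subst (x ∈_) (sym νσ≡σ) x∈))
  ... | inj₁ x≤νx = antisym (subst (ν x ≤_) (νν x) (Equivalence.to (aut x (ν x)) x≤νx)) x≤νx
  ... | inj₂ νx≤x = antisym νx≤x (subst (_≤ ν x) (νν x) (Equivalence.to (aut (ν x) x) νx≤x))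

  G-chain-fixed : ∀ {σ} → IsChainIn P G σ → νs σ ≡ σ
  G-chain-fixed {σ} (σ⊆G , _) = subset-ext
    (λ x x∈ → subst (_∈ σ) (trans (sym (fix (∈-νs⁻ x∈))) (νν x)) (∈-νs⁻ x∈))
    (λ x x∈ → ∈-νs⁺ (subst (_∈ σ) (sym (fix x∈)) x∈))
    where
    fix : ∀ {x} → x ∈ σ → ν x ≡ x
    fix x∈ = G⇒fixed (σ⊆G _ x∈)

  -- A chain of P preserved by ν is fixed pointwise, so π restricts to the faces lying in G.
  ν♯ τ π : Chain n → Chain n
  ν♯ c σ = c (νs σ)
  τ c    = c + ν♯ c
  π c σ  = c σ ∧ eqᵇ (νs σ) σ

  Inv : Chain n → Set
  Inv c = ν♯ c ≗ c

  δ-ν♯ : ∀ c → δ (ν♯ c) ≗ ν♯ (δ c)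
  δ-ν♯ c σ = begin
    δ (ν♯ c) σ                ≡⟨ δ-sum (ν♯ c) σ ⟩
    sum (face (ν♯ c) σ)       ≡⟨ sum-cong-≗ faces ⟩
    sum (face c (νs σ) ∘ ν)   ≡⟨ sum-involution ν νν (face c (νs σ)) ⟩
    sum (face c (νs σ))       ≡⟨ δ-sum c (νs σ) ⟨
    δ c (νs σ)                ∎
    where
    open ≡-Reasoning
    faces : ∀ x → face (ν♯ c) σ x ≡ face c (νs σ) (ν x)
    faces x with x ∈? σ
    ... | yes x∈σ = sym (face-∈ c (ν-∈ x∈σ))
    ... | no x∉σ = trans (cong c (νs-∪ σ x))
      (sym (face-∉ c (λ νx∈ → x∉σ (subst (_∈ σ) (νν x) (∈-νs⁻ νx∈)))))

  δ-τ : ∀ c → δ (τ c) ≗ τ (δ c)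
  δ-τ c σ = trans (δ-+ c (ν♯ c) σ) (cong (δ c σ xor_) (δ-ν♯ c σ))

  τ-cong : ∀ {c d} → c ≗ d → τ c ≗ τ d
  τ-cong c≗d σ = cong₂ _xor_ (c≗d σ) (c≗d (νs σ))

  τ-+ : ∀ c d → τ (c + d) ≗ τ c + τ d
  τ-+ c d σ = solve 4 (λ x y z w → (x :+ y) :+ (z :+ w) := (x :+ z) :+ (y :+ w)) refl
    (c σ) (d σ) (c (νs σ)) (d (νs σ))

  τ≗0⇒inv : ∀ {c} → τ c ≗ 0c → Inv c
  τ≗0⇒inv τc≗0 σ = sym (xor≡false⇒≡ (τc≗0 σ))

  inv⇒τ≗0 : ∀ {c} → Inv c → τ c ≗ 0c
  inv⇒τ≗0 {c} inv σ = trans (cong (c σ xor_) (inv σ)) (xor-same (c σ))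

  inv-τ : ∀ c → Inv (τ c)
  inv-τ c σ = trans (cong (c (νs σ) xor_) (cong c (νsνs σ))) (xor-comm (c (νs σ)) (c σ))

  inv-+ : ∀ {c d} → Inv c → Inv d → Inv (c + d)
  inv-+ c-inv d-inv σ = cong₂ _xor_ (c-inv σ) (d-inv σ)

  inv-cong : ∀ {c d} → c ≗ d → Inv c → Inv d
  inv-cong c≗d inv σ = trans (sym (c≗d (νs σ))) (trans (inv σ) (c≗d σ))

  inv-δ : ∀ {c} → Inv c → Inv (δ c)
  inv-δ {c} inv σ = trans (sym (δ-ν♯ c σ)) (δ-cong inv σ)

  δ-+δ : ∀ b e → δ (b + δ e) ≗ δ b
  δ-+δ b e σ = trans (δ-+ b (δ e) σ) (trans (cong (δ b σ xor_) (δδ e σ)) (xor-identityʳ _))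

  supp-ν♯ : ∀ {m c} → C m c → C m (ν♯ c)
  supp-ν♯ supp σ eq with supp (νs σ) eq
  ... | chain , card = ν-chain chain , trans (sym (∣νs∣ σ)) card

  supp-τ : ∀ {m c} → C m c → C m (τ c)
  supp-τ supp = supp-+ supp (supp-ν♯ supp)

  supp-∧ : ∀ {m c} (f : Chain n) → C m c → C m (λ σ → c σ ∧ f σ)
  supp-∧ {c = c} f supp σ eq with c σ in cσ
  ... | true = supp σ cσ

  G⇒Q-supp : ∀ {m c} → D m c → C m c
  G⇒Q-supp supp σ eq with supp σ eq
  ... | (σ⊆G , total) , card = ((λ x x∈ → G⇒Q (σ⊆G x x∈)) , total) , card

  supp-π : ∀ {m c} → C m c → D m (π c)
  supp-π {c = c} supp σ eq with c σ in cσ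
  ... | true with supp σ cσ
  ...   | chain@(σ⊆Q , total) , card =
    ((λ x x∈ → fixed⇒G (fixed-chain chain (eqᵇ⇒≡ (νs σ) σ eq) x x∈) (σ⊆Q x x∈)) , total) , card

  inv-G : ∀ {m f} → D m f → Inv f
  inv-G {f = f} F σ with f σ in fσ | f (νs σ) in fνσ
  ... | true  | true  = refl
  ... | false | false = refl
  ... | true  | false = trans (sym fνσ) (trans (cong f (G-chain-fixed (proj₁ (F σ fσ)))) fσ)
  ... | false | true  = sym (trans (sym fσ) (trans (cong f (trans (sym (νsνs σ)) (G-chain-fixed (proj₁ (F (νs σ) fνσ))))) fνσ))

  π-cong : ∀ {c d} → c ≗ d → π c ≗ π d
  π-cong c≗d σ = cong (_∧ eqᵇ (νs σ) σ) (c≗d σ)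

  π-+ : ∀ c d → π (c + d) ≗ π c + π d
  π-+ c d σ = ∧-distribʳ-xor (eqᵇ (νs σ) σ) (c σ) (d σ)

  -- On a fixed face the two terms of `τ c` coincide and cancel.
  π-τ : ∀ c → π (τ c) ≗ 0c
  π-τ c σ with eqᵇ (νs σ) σ in eq
  ... | false = ∧-zeroʳ _
  ... | true  = trans (∧-identityʳ _) (trans (cong (λ ρ → c σ xor c ρ) (eqᵇ⇒≡ (νs σ) σ eq)) (xor-same (c σ)))

  π-fixed : ∀ {c} → (∀ σ → c σ ≡ true → νs σ ≡ σ) → π c ≗ c
  π-fixed {c} fix σ with c σ in cσ
  ... | false = refl
  ... | true  = trans (cong (λ ρ → eqᵇ ρ σ) (fix σ cσ)) (eqᵇ-refl σ)

  π-G : ∀ {m f} → D m f → π f ≗ f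
  π-G F = π-fixed (λ σ fσ → G-chain-fixed (proj₁ (F σ fσ)))

  π-δG : ∀ {m f} → D m f → π (δ f) ≗ δ f
  π-δG {f = f} F = π-fixed fix
    where
    fix : ∀ σ → δ f σ ≡ true → νs σ ≡ σ
    fix σ eq with δ-true {f} eq
    ... | x , _ , fσx = G-chain-fixed (⊆-chain (λ y → p⊆p∪q ⁅ x ⁆) (proj₁ (F _ fσx)))

  -- The order lexᵇ selects one face out of every pair {σ, ν σ}.
  decompose : ∀ {m u} → C m u → Inv u → ∃ λ a → C m a × u ≗ τ a + π u
  decompose {u = u} U inv = (λ σ → u σ ∧ lexᵇ σ (νs σ)) , supp-∧ (λ σ → lexᵇ σ (νs σ)) U , eq
    where
    eq : ∀ σ → u σ ≡ ((u σ ∧ lexᵇ σ (νs σ)) xor (u (νs σ) ∧ lexᵇ (νs σ) (νs (νs σ)))) xor (u σ ∧ eqᵇ (νs σ) σ)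
    eq σ rewrite inv σ | νsνs σ with u σ
    ... | false = refl
    ... | true  = sym (lexᵇ-trichotomous σ (νs σ))

  -- Deleting a point from a face that is not fixed may leave a fixed one, so invariance of `u`
  -- matters: such faces then come in pairs. In the decomposition of `u`, the summand `τ a`
  -- contributes `τ (δ a)`, which `π` kills, and the boundary of `π u` is already made of fixed
  -- faces.
  δ-π : ∀ {m u} → C m u → Inv u → δ (π u) ≗ π (δ u)
  δ-π {m} {u} U inv σ with a , _ , u≗ ← decompose U inv = sym (begin
    π (δ u) σ                          ≡⟨ π-cong (δ-cong u≗) σ ⟩
    π (δ (τ a + π u)) σ                ≡⟨ π-cong (δ-+ (τ a) (π u)) σ ⟩
    π (δ (τ a) + δ (π u)) σ            ≡⟨ π-+ (δ (τ a)) (δ (π u)) σ ⟩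
    π (δ (τ a)) σ xor π (δ (π u)) σ    ≡⟨ cong₂ _xor_ (trans (π-cong (δ-τ a) σ) (π-τ (δ a) σ)) (π-δG (supp-π U) σ) ⟩
    δ (π u) σ                          ∎)
    where open ≡-Reasoning

  -- The class of a relative to the invariant chains vanishes.
  Averaged : ℕ → Chain n → Set
  Averaged m a = ∃ λ e → C (suc m) e × Inv (a + δ e)

  InvBoundary : ℕ → Chain n → Set
  InvBoundary m u = ∃ λ b → C (suc m) b × Inv b × δ b ≗ u

  -- The splitting into τC and C(Fix) respects boundaries. The part `π b` is a cycle because `π`
  -- kills `τ a`, so `τ a` is already the boundary of `τ e`, and `a + δ e` is annihilated by `τ`.
  averaged-τ : ∀ {m a} → InvBoundary m (τ a) → Averaged m a
  averaged-τ {m} {a} (b , B , b-inv , δb) with e , E , b≗ ← decompose B b-inv = e , E , τ≗0⇒inv eq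
    where
    open ≡-Reasoning
    δb≗τδe : δ b ≗ τ (δ e)
    δb≗τδe σ = begin
      δ b σ                        ≡⟨ δ-cong b≗ σ ⟩
      δ (τ e + π b) σ              ≡⟨ δ-+ (τ e) (π b) σ ⟩
      δ (τ e) σ xor δ (π b) σ      ≡⟨ cong₂ _xor_ (δ-τ e σ) (trans (δ-π B b-inv σ) (trans (π-cong δb σ) (π-τ a σ))) ⟩
      τ (δ e) σ xor false          ≡⟨ xor-identityʳ _ ⟩
      τ (δ e) σ                    ∎
    eq : τ (a + δ e) ≗ 0c
    eq σ = begin
      τ (a + δ e) σ               ≡⟨ τ-+ a (δ e) σ ⟩
      τ a σ xor τ (δ e) σ         ≡⟨ cong₂ _xor_ (δb σ) (δb≗τδe σ) ⟨
      δ b σ xor δ b σ             ≡⟨ xor-same (δ b σ) ⟩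
      false                       ∎

  -- Adding `δ e` to `b` makes it invariant and leaves its boundary unchanged.
  averaged-boundary : ∀ {m u b} → C (suc m) b → δ b ≗ u → Averaged (suc m) b → InvBoundary m u
  averaged-boundary {b = b} B δb (e , E , inv) =
    b + δ e , supp-+ B (supp-δ E) , inv , λ σ → trans (δ-+δ b e σ) (δb σ)

  π-boundary : ∀ {m u f} → InvBoundary m u → π u ≗ f → Boundary P G m f
  π-boundary (b , B , inv , δb) πu =
    π b , supp-π B , λ σ → trans (δ-π B inv σ) (trans (π-cong δb σ) (πu σ))

  -- The fixed points of an involution on a homology sphere

  module _ {d} (sphere : HomologySphere P Q d) where

    private
      z    = proj₁ (proj₁ sphere)
      zc   = proj₁ (proj₂ (proj₁ sphere))
      z≁0  = proj₁ (proj₂ (proj₂ (proj₁ sphere)))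
      0∨z  = proj₂ (proj₂ (proj₂ (proj₁ sphere)))
      acyclic = proj₂ sphere

    -- Downward induction, starting above the number of points, where there are no chains.
    averaged-above : ∀ {m} → d ℕ.< m → ∀ {a} → C m a → Inv (δ a) → Averaged m a
    averaged-above {m} = go (suc n) (ℕ.s≤s (ℕ.m≤m+n n m))
      where
      go : ∀ k {m} → n ℕ.< k ℕ.+ m → d ℕ.< m → ∀ {a} → C m a → Inv (δ a) → Averaged m a
      go zero {m} n<m d<m {a} A _ = 0c , supp-0 , λ σ → trans (a≗0 (νs σ)) (sym (a≗0 σ))
        where
        a≗0 : a + δ 0c ≗ 0c
        a≗0 σ with a σ in aσ
        ... | false = δ-0 σ
        ... | true  = contradiction (subst (ℕ._≤ n) (proj₂ (A σ aσ)) (∣p∣≤n σ)) (ℕ.<⇒≱ n<m)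
      go (suc k) {m} n<k d<m {a} A inv
        with b , B , δb ← acyclic m (ℕ.>⇒≢ d<m) (τ a)
               (supp-τ A , λ σ → trans (δ-τ a σ) (inv⇒τ≗0 {δ a} inv σ))
        = averaged-τ {a = a} (averaged-boundary B δb
            (go k (subst (n ℕ.<_) (sym (ℕ.+-suc k m)) n<k) (ℕ.m<n⇒m<1+n d<m) B
              (inv-cong (λ σ → sym (δb σ)) (inv-τ a))))

    -- The bounding chain has size above `d`, where `averaged-above` makes it invariant.
    inv-boundary : ∀ {m u} → d ℕ.≤ m → Inv u → Boundary P Q m u → InvBoundary m u
    inv-boundary d≤m inv (b , B , δb) =
      averaged-boundary B δb (averaged-above (ℕ.s≤s d≤m) B (inv-cong (λ σ → sym (δb σ)) inv))

    -- The class of u survives the iterated lifts u = ∂ b ↦ τ b up to degree d, where it becomes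
    -- the fundamental class of Q.
    Survives : ℕ → ℕ → Chain n → Set
    Survives zero    m u = Boundary P Q m (u + z)
    Survives (suc j) m u = ∃ λ b → C (suc m) b × δ b ≗ u × Survives j (suc m) (τ b)

    private
      d≢m : ∀ {j m} → suc j ℕ.+ m ≡ d → m ≢ d
      d≢m {j} eq refl = ℕ.1+n≰n (ℕ.≤-trans (ℕ.s≤s (ℕ.m≤n+m _ j)) (ℕ.≤-reflexive eq))

      shift : ∀ {j m} → suc j ℕ.+ m ≡ d → j ℕ.+ suc m ≡ d
      shift {j} {m} eq = trans (ℕ.+-suc j m) eq

      δτ≗0 : ∀ {b u} → δ b ≗ u → Inv u → δ (τ b) ≗ 0c
      δτ≗0 {b} {u} δb inv σ = trans (δ-τ b σ) (trans (τ-cong δb σ) (inv⇒τ≗0 {u} inv σ))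

    invBoundary-cong : ∀ {m u v} → u ≗ v → InvBoundary m u → InvBoundary m v
    invBoundary-cong u≗v (b , B , inv , δb) = b , B , inv , λ σ → trans (δb σ) (u≗v σ)

    invBoundary-+ : ∀ {m u v} → InvBoundary m u → InvBoundary m v → InvBoundary m (u + v)
    invBoundary-+ {u = u} {v} (b , B , b-inv , δb) (c , D , c-inv , δc) =
      b + c , supp-+ B D , inv-+ {b} {c} b-inv c-inv , λ σ → trans (δ-+ b c σ) (cong₂ _xor_ (δb σ) (δc σ))

    invBoundary-τ : ∀ {m u b} → C (suc m) b → δ b ≗ u → InvBoundary (suc m) (τ b) → InvBoundary m u
    invBoundary-τ {b = b} B δb ib = averaged-boundary B δb (averaged-τ {a = b} ib)

    -- Here `j` counts the lifts left before size `d`. If the lift `τ b` bounds invariantly,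
    -- `invBoundary-τ` carries this back to `u`; at size `d` the alternative comes from the homology
    -- being ℤ₂.
    bounds∨survives : ∀ j {m u} → j ℕ.+ m ≡ d → Cycle P Q m u → Inv u → InvBoundary m u ⊎ Survives j m u
    bounds∨survives zero {m} {u} refl cyc inv = Sum.map₁ (inv-boundary ℕ.≤-refl inv) (0∨z u cyc)
    bounds∨survives (suc j) {m} {u} eq cyc inv
      with b , B , δb ← acyclic m (d≢m {j} eq) u cyc
      with bounds∨survives j (shift {j} eq) (supp-τ B , δτ≗0 {b} δb inv) (inv-τ b)
    ... | inj₁ ib = inj₁ (invBoundary-τ B δb ib)
    ... | inj₂ s  = inj₂ (b , B , δb , s)

    -- Both classes end as that of `z`, so the sum of their final lifts bounds, and this descends
    -- through the lifts one size at a time.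
    survives-+ : ∀ j {m u v} → j ℕ.+ m ≡ d → Inv u → Inv v →
      Survives j m u → Survives j m v → InvBoundary m (u + v)
    survives-+ zero {m} {u} {v} refl u-inv v-inv (b , B , δb) (c , D , δc) =
      inv-boundary ℕ.≤-refl (inv-+ {u} {v} u-inv v-inv) (b + c , supp-+ B D , eq)
      where
      eq : δ (b + c) ≗ u + v
      eq σ = trans (δ-+ b c σ) (trans (cong₂ _xor_ (δb σ) (δc σ))
        (solve 3 (λ x y w → (x :+ w) :+ (y :+ w) := x :+ y) refl (u σ) (v σ) (z σ)))
    survives-+ (suc j) {m} {u} {v} eq u-inv v-inv (b , B , δb , s) (c , D , δc , t) =
      invBoundary-τ (supp-+ B D)
        (λ σ → trans (δ-+ b c σ) (cong₂ _xor_ (δb σ) (δc σ)))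
        (invBoundary-cong (λ σ → sym (τ-+ b c σ)) (survives-+ j (shift {j} eq) (inv-τ b) (inv-τ c) s t))

    private
      +-cancelʳ : ∀ u v → (u + v) + v ≗ u
      +-cancelʳ u v σ = solve 2 (λ x y → (x :+ y) :+ y := x) refl (u σ) (v σ)

      boundary⇒inv : ∀ {m f} → Boundary P G m f → InvBoundary m f
      boundary⇒inv (g , G′ , δg) = g , G⇒Q-supp G′ , inv-G G′ , δg

    -- Lifted to size `m′`, the class of `u` becomes that of some `τ b`, and `τ b + v` bounds
    -- invariantly because both survive. Applying `π` leaves `v`, which therefore bounds in `G`;
    -- adding `v` back then makes `τ b`, and with it `u`, bound invariantly.
    survives-distinct : ∀ j {m u} j′ {m′ v} → j ℕ.+ m ≡ d → j′ ℕ.+ m′ ≡ d → m ℕ.< m′ →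
      D m′ v → Survives j m u → Survives j′ m′ v →
      Boundary P G m′ v × (Boundary P G m′ v → InvBoundary m u)
    survives-distinct zero {m} j′ {m′} refl eq′ m<m′ V s t =
      contradiction (ℕ.≤-trans (ℕ.m≤n+m m′ j′) (ℕ.≤-reflexive eq′)) (ℕ.<⇒≱ m<m′)
    survives-distinct (suc j) {m} j′ {m′} {v} eq eq′ m<m′ V (b , B , δb , s) t
      with ℕ.m≤n⇒m<n∨m≡n m<m′
    ... | inj₁ 1+m<m′ with bv , v⇒b ← survives-distinct j j′ (shift {j} eq) eq′ 1+m<m′ V s t =
      bv , λ bv → invBoundary-τ B δb (v⇒b bv)
    -- Equal sizes leave equally many lifts, so `survives-+` applies to `τ b` and `v`.
    ... | inj₂ refl with refl ← ℕ.+-cancelʳ-≡ (suc m) j j′ (trans (shift {j} eq) (sym eq′)) =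
      π-boundary τb+v (λ σ → trans (π-+ (τ b) v σ) (cong₂ _xor_ (π-τ b σ) (π-G V σ))) ,
      λ bv → invBoundary-τ B δb (invBoundary-cong (+-cancelʳ (τ b) v) (invBoundary-+ τb+v (boundary⇒inv bv)))
      where τb+v = survives-+ j (shift {j} eq) (inv-τ b) (inv-G V) s t

    -- The alternative R serves twice: to search for a nonbounding cycle of G, and, with an
    -- arbitrary goal in its place, to refute that all cycles of G bound.
    module _ {R : Set} (bounds : ∀ m f → Cycle P G m f → Boundary P G m f ⊎ R) where

      private
        -- The involution fixes the nonzero class of ℤ₂: otherwise `τ z + z`, which is `ν♯ z`, would
        -- bound, and applying `ν♯` would make `z` bound.
        z-averaged : Averaged d z
        z-averaged with 0∨z (τ z) (supp-τ (proj₁ zc) , δτ≗0 {z} {0c} (proj₂ zc) (λ _ → refl))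
        ... | inj₁ bτz = averaged-τ {a = z} (inv-boundary ℕ.≤-refl (inv-τ z) bτz)
        ... | inj₂ (b , B , δb) = ⊥-elim (z≁0 (ν♯ b , supp-ν♯ B , eq))
          where
          eq : δ (ν♯ b) ≗ z
          eq σ = trans (δ-ν♯ b σ) (trans (δb (νs σ)) (trans
            (solve 2 (λ x y → (x :+ y) :+ x := y) refl (z (νs σ)) (z (νs (νs σ))))
            (cong z (νsνs σ))))

        -- A bounding cycle is cancelled by its bounding chain; one homologous to `z` is reduced to
        -- `z-averaged`.
        cycle-averaged : ∀ {m c} → m ℕ.≤ d → Cycle P Q m c → Averaged m c
        cycle-averaged {m} {c} m≤d cyc with m ℕ.≟ d
        ... | no m≢d with b , B , δb ← acyclic m m≢d c cyc = b , B , λ σ → trans (c+δb (νs σ)) (sym (c+δb σ))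
          where
          c+δb : c + δ b ≗ 0c
          c+δb σ = trans (cong (c σ xor_) (δb σ)) (xor-same (c σ))
        ... | yes refl with 0∨z c cyc | z-averaged
        ...   | inj₁ (b , B , δb) | _ = b , B , λ σ → trans (c+δb (νs σ)) (sym (c+δb σ))
          where
          c+δb : c + δ b ≗ 0c
          c+δb σ = trans (cong (c σ xor_) (δb σ)) (xor-same (c σ))
        ...   | inj₂ (b , B , δb) | e , E , z+δe = b + e , supp-+ B E , inv-cong (λ σ → sym (eq σ)) z+δe
          where
          eq : c + δ (b + e) ≗ z + δ e
          eq σ = trans (cong (c σ xor_) (trans (δ-+ b e σ) (cong (_xor δ e σ) (δb σ))))
            (solve 3 (λ x y w → x :+ ((x :+ y) :+ w) := y :+ w) refl (c σ) (z σ) (δ e σ))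

        -- The fixed part `π u` is a cycle of `G` and is replaced by a bounding chain `g`. The cycle
        -- condition on the remaining `τ a` says that `τ` annihilates `δ a`.
        split : ∀ {m u} → Cycle P Q m u → Inv u →
          (∃ λ a → ∃ λ g → C m a × D (suc m) g × u ≗ τ a + δ g × Inv (δ a)) ⊎ R
        split {m} {u} (U , δu) inv with a , A , u≗ ← decompose U inv
          with bounds m (π u) (supp-π U , λ σ → trans (δ-π U inv σ) (π-cong δu σ))
        ... | inj₂ r = inj₂ r
        ... | inj₁ (g , G′ , δg) = inj₁ (a , g , A , G′ ,
          (λ σ → trans (u≗ σ) (cong (τ a σ xor_) (sym (δg σ)))) ,
          τ≗0⇒inv λ σ → trans (sym (δ-τ a σ)) (xor≡false⇒≡ (trans (cong (δ (τ a) σ xor_) (sym (δδ g σ)))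
            (trans (sym (δ-+ (τ a) (δ g) σ)) (trans (δ-cong (λ σ → sym (trans (u≗ σ) (cong (τ a σ xor_) (sym (δg σ))))) σ) (δu σ))))))

      -- Upward induction. If `δ a ≗ τ e + δ g` and `b` averages `e`, then `τ e ≗ δ (τ b)`, so
      -- `a + (g + τ b)` is a cycle and can be averaged. As `g + τ b` is invariant, the same
      -- correction averages `a`.
      averaged-below : ∀ m → m ℕ.≤ d → ∀ {a} → C m a → Inv (δ a) → Averaged m a ⊎ R
      averaged-below zero _ {a} A _ = inj₁ (0c , supp-0 , inv-+ {a} {δ 0c} a-inv (inv-δ {0c} (λ _ → refl)))
        where
        -- The only face of size zero is the empty chain, which `νs` fixes.
        νσ≡σ : ∀ {σ} → ∣ σ ∣ ≡ 0 → νs σ ≡ σ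
        νσ≡σ {σ} card = subset-ext (λ x x∈ → ⊥-elim (∈⇒∣∣≢0 x∈ (trans (∣νs∣ σ) card)))
          (λ x x∈ → ⊥-elim (∈⇒∣∣≢0 x∈ card))
        a-inv : Inv a
        a-inv σ with a σ in aσ | a (νs σ) in aνσ
        ... | true  | true  = refl
        ... | false | false = refl
        ... | true  | false = trans (sym aνσ) (trans (cong a (νσ≡σ (proj₂ (A σ aσ)))) aσ)
        ... | false | true  = sym (trans (sym aσ) (trans (cong a (sym (νσ≡σ (trans (sym (∣νs∣ σ)) (proj₂ (A (νs σ) aνσ)))))) aνσ))
      averaged-below (suc m) 1+m≤d {a} A inv
        with split (supp-δ A , δδ a) inv
      ... | inj₂ r = inj₂ r
      ... | inj₁ (e , g , E , G′ , δa≗ , δe-inv)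
        with averaged-below m (ℕ.<⇒≤ 1+m≤d) E δe-inv
      ...   | inj₂ r = inj₂ r
      ...   | inj₁ (b , B , e+δb) = inj₁ (conclude (cycle-averaged 1+m≤d (W , δw)))
        where
        w = a + (g + τ b)
        W : C (suc m) w
        W = supp-+ A (supp-+ (G⇒Q-supp G′) (supp-τ B))
        conclude : Averaged (suc m) w → Averaged (suc m) a
        conclude (e′ , E′ , w-inv) = e′ , E′ , inv-cong
          (λ σ → solve 3 (λ x y t → ((x :+ y) :+ t) :+ y := x :+ t) refl (a σ) ((g + τ b) σ) (δ e′ σ))
          (inv-+ {w + δ e′} {g + τ b} w-inv (inv-+ {g} {τ b} (inv-G G′) (inv-τ b)))
        δw : δ w ≗ 0c
        δw σ = begin
          δ w σ                                            ≡⟨ δ-+ a (g + τ b) σ ⟩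
          δ a σ xor δ (g + τ b) σ                          ≡⟨ cong₂ _xor_ (δa≗ σ) (δ-+ g (τ b) σ) ⟩
          (τ e σ xor δ g σ) xor (δ g σ xor δ (τ b) σ)
            ≡⟨ solve 3 (λ x y t → (x :+ y) :+ (y :+ t) := x :+ t) refl (τ e σ) (δ g σ) (δ (τ b) σ) ⟩
          τ e σ xor δ (τ b) σ                              ≡⟨ cong (τ e σ xor_) (δ-τ b σ) ⟩
          τ e σ xor τ (δ b) σ                              ≡⟨ τ-+ e (δ b) σ ⟨
          τ (e + δ b) σ                                    ≡⟨ inv⇒τ≗0 {e + δ b} e+δb σ ⟩
          false                                            ∎
          where open ≡-Reasoning

      -- Unless `R` occurs, an invariant representative `z + δ b₀` equals `τ e + δ g` with `e`
      -- averaged by some `b`. Then `τ e ≗ δ (τ b)`, and `z` would be the boundary of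
      -- `b₀ + (τ b + g)`.
      nonbounding : R
      nonbounding with b₀ , B₀ , inv₀ ← z-averaged
        with split (supp-+ (proj₁ zc) (supp-δ B₀) , λ σ → trans (δ-+δ z b₀ σ) (proj₂ zc σ)) inv₀
      ... | inj₂ r = r
      ... | inj₁ (e , g , E , G′ , z+δb₀≗ , δe-inv) with averaged-below d ℕ.≤-refl E δe-inv
      ...   | inj₂ r = r
      ...   | inj₁ (b , B , e+δb) = ⊥-elim (z≁0 (b₀ + (τ b + g) ,
                supp-+ B₀ (supp-+ (supp-τ B) (G⇒Q-supp G′)) , eq))
        where
        open ≡-Reasoning
        τδb≗τe : ∀ σ → δ (τ b) σ ≡ τ e σ
        τδb≗τe σ = trans (δ-τ b σ) (sym (xor≡false⇒≡ (trans (sym (τ-+ e (δ b) σ)) (inv⇒τ≗0 {e + δ b} e+δb σ))))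
        eq : δ (b₀ + (τ b + g)) ≗ z
        eq σ = begin
          δ (b₀ + (τ b + g)) σ                  ≡⟨ δ-+ b₀ (τ b + g) σ ⟩
          δ b₀ σ xor δ (τ b + g) σ              ≡⟨ cong (δ b₀ σ xor_) (δ-+ (τ b) g σ) ⟩
          δ b₀ σ xor (δ (τ b) σ xor δ g σ)      ≡⟨ cong (λ t → δ b₀ σ xor (t xor δ g σ)) (τδb≗τe σ) ⟩
          δ b₀ σ xor (τ e σ xor δ g σ)          ≡⟨ cong (δ b₀ σ xor_) (z+δb₀≗ σ) ⟨
          δ b₀ σ xor (z σ xor δ b₀ σ)           ≡⟨ solve 2 (λ x y → x :+ (y :+ x) := y) refl (δ b₀ σ) (z σ) ⟩
          z σ                                   ∎

    private
      boundary-+ : ∀ {m f g} → Boundary P G m (f + g) → Boundary P G m g → Boundary P G m f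
      boundary-+ {f = f} {g} (b , B , δb) (c , E , δc) = b + c , supp-+ B E ,
        λ σ → trans (δ-+ b c σ) (trans (cong₂ _xor_ (δb σ) (δc σ)) (+-cancelʳ f g σ))

      G-cycle : ∀ {m f} → Cycle P G m f → Cycle P Q m f
      G-cycle (F , δf) = G⇒Q-supp F , δf

      Found : Set
      Found = ∃ λ j → ∃ λ m → ∃ λ f → j ℕ.+ m ≡ d × Cycle P G m f × Survives j m f

      -- Above size `d` the complex of `Q` is acyclic and bounding chains can be made invariant; up
      -- to `d` the lifts decide. In either case `π` brings an invariant bounding chain into `G`.
      decide : ∀ m f → Cycle P G m f →
        Boundary P G m f ⊎ ∃ λ j → j ℕ.+ m ≡ d × Survives j m f
      decide m f cyc@(F , δf) with m ℕ.≤? d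
      ... | no m≰d = inj₁ (π-boundary (inv-boundary (ℕ.<⇒≤ (ℕ.≰⇒> m≰d)) (inv-G F)
              (acyclic m (λ { refl → m≰d ℕ.≤-refl }) f (G-cycle cyc))) (π-G F))
      ... | yes m≤d with bounds∨survives (d ℕ.∸ m) (ℕ.m∸n+n≡m m≤d) (G-cycle cyc) (inv-G F)
      ...   | inj₁ ib = inj₁ (π-boundary ib (π-G F))
      ...   | inj₂ s  = inj₂ (d ℕ.∸ m , ℕ.m∸n+n≡m m≤d , s)

      found : Found
      -- With `R` taken as the object sought, the first surviving cycle met in the argument is
      -- returned.
      found = nonbounding λ m f cyc → Sum.map₂ (λ (j , eq , s) → j , m , f , eq , cyc , s) (decide m f cyc)

    module _ {j₀ k f₀} (eq₀ : j₀ ℕ.+ k ≡ d) (cyc₀ : Cycle P G k f₀) (s₀ : Survives j₀ k f₀) where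

      private
        F₀ = proj₁ cyc₀

      same-degree : ∀ {j f} → j ℕ.+ k ≡ d → D k f → Survives j k f → Boundary P G k (f + f₀)
      same-degree {j} {f} eq F s with refl ← ℕ.+-cancelʳ-≡ k j j₀ (trans eq (sym eq₀)) =
        π-boundary (survives-+ j eq (inv-G F) (inv-G F₀) s s₀)
          (λ σ → trans (π-+ f f₀ σ) (cong₂ _xor_ (π-G F σ) (π-G F₀ σ)))

      -- Were `f₀` to bound, every cycle of `G` would: a survivor of smaller or larger size by the
      -- two halves of `survives-distinct`, one of equal size because its sum with `f₀` bounds. This
      -- is refuted by `nonbounding` with an empty alternative.
      f₀≁0 : ¬ Boundary P G k f₀
      f₀≁0 bf₀ = nonbounding λ m f cyc → inj₁ (bound m f cyc)
        where
        bound : ∀ m f → Cycle P G m f → Boundary P G m f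
        bound m f cyc@(F , _) with decide m f cyc
        ... | inj₁ bf = bf
        ... | inj₂ (j , eq , s) with ℕ.<-cmp m k
        ...   | tri< m<k _ _ = π-boundary (proj₂ (survives-distinct j j₀ eq eq₀ m<k F₀ s s₀) bf₀) (π-G F)
        ...   | tri≈ _ refl _ = boundary-+ (same-degree {j} eq F s) bf₀
        ...   | tri> _ _ k<m = proj₁ (survives-distinct j₀ j eq₀ eq k<m F s₀ s)

      classes : ∀ f → Cycle P G k f → Boundary P G k f ⊎ Boundary P G k (f + f₀)
      classes f cyc = Sum.map₂ (λ (j , eq , s) → same-degree {j} eq (proj₁ cyc) s) (decide k f cyc)

      -- A survivor of size below `k` would force `f₀` to bound; one of size above `k` is itself
      -- forced to bound.
      others : ∀ m → m ≢ k → HomologyZero P G m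
      others m m≢k f cyc@(F , _) with decide m f cyc
      ... | inj₁ bf = bf
      ... | inj₂ (j , eq , s) with ℕ.<-cmp m k
      ...   | tri< m<k _ _ = contradiction (proj₁ (survives-distinct j j₀ eq eq₀ m<k F₀ s s₀)) f₀≁0
      ...   | tri≈ _ m≡k _ = contradiction m≡k m≢k
      ...   | tri> _ _ k<m = proj₁ (survives-distinct j₀ j eq₀ eq k<m F s₀ s)

      found-sphere : HomologySphere P G k
      found-sphere = (f₀ , cyc₀ , f₀≁0 , classes) , others

    fixed-sphere : ∃ (HomologySphere P G)
    fixed-sphere = package found
      where
      package : Found → ∃ (HomologySphere P G)
      package (_ , k , _ , eq₀ , cyc₀ , s₀) = k , found-sphere eq₀ cyc₀ s₀

-- Purity of posets whose open intervals are homology spheres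

bool-ext : {x y : Bool} → (x ≡ true → y ≡ true) → (y ≡ true → x ≡ true) → x ≡ y
bool-ext {true}  {y}     x⇒y _ = sym (x⇒y refl)
bool-ext {false} {false} _ _   = refl
bool-ext {false} {true}  _ y⇒x = y⇒x refl

does-true : {A : Set} (a? : Dec A) → does a? ≡ true → A
does-true (yes a) _ = a

∣σ∣≡0⇒σ≡⊥ : {σ : Subset n} → ∣ σ ∣ ≡ 0 → σ ≡ Subset.⊥
∣σ∣≡0⇒σ≡⊥ card = Empty-unique λ (_ , x∈) → ∈⇒∣∣≢0 x∈ card

∣σ∣≡1+k⇒nonempty : ∀ {k} {σ : Subset n} → ∣ σ ∣ ≡ suc k → Nonempty σ
∣σ∣≡1+k⇒nonempty {n} {σ = σ} card with nonempty? σ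
... | yes ne = ne
... | no ¬ne with () ← trans (sym card) (trans (cong ∣_∣ (Empty-unique ¬ne)) (∣⊥∣≡0 n))

∣σ∣≡1⇒singleton : {σ : Subset n} → ∣ σ ∣ ≡ 1 → ∃ λ x → σ ≡ ⁅ x ⁆
∣σ∣≡1⇒singleton {σ = inside ∷ σ}  card = zero , cong (inside ∷_) (∣σ∣≡0⇒σ≡⊥ (ℕ.suc-injective card))
∣σ∣≡1⇒singleton {σ = outside ∷ σ} card with x , refl ← ∣σ∣≡1⇒singleton {σ = σ} card = suc x , refl

∣σ∪τ∣ : (σ τ : Subset n) → (∀ x → x ∈ σ → x ∉ τ) → ∣ σ ∪ τ ∣ ≡ ∣ σ ∣ ℕ.+ ∣ τ ∣
∣σ∪τ∣ []            []            _        = refl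
∣σ∪τ∣ (inside ∷ σ)  (inside ∷ τ)  disjoint = contradiction here (disjoint zero here)
∣σ∪τ∣ (inside ∷ σ)  (outside ∷ τ) disjoint = cong suc (∣σ∪τ∣ σ τ λ x x∈σ x∈τ → disjoint (suc x) (there x∈σ) (there x∈τ))
∣σ∪τ∣ (outside ∷ σ) (inside ∷ τ)  disjoint =
  trans (cong suc (∣σ∪τ∣ σ τ λ x x∈σ x∈τ → disjoint (suc x) (there x∈σ) (there x∈τ))) (sym (ℕ.+-suc ∣ σ ∣ ∣ τ ∣))
∣σ∪τ∣ (outside ∷ σ) (outside ∷ τ) disjoint = ∣σ∪τ∣ σ τ λ x x∈σ x∈τ → disjoint (suc x) (there x∈σ) (there x∈τ)

extremal : {_⊏_ : Rel (Fin n) 0ℓ} → (∀ x y → Dec (x ⊏ y)) → {T : Pred (Fin n) 0ℓ} → Decidable T →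
  ∀ {t} → Acc (flip _⊏_) t → T t → ∃ λ m → T m × (∀ x → T x → ¬ (m ⊏ x))
extremal _⊏?_ T? {t} (acc rs) Tt with Fin.any? (λ x → T? x ×-dec (t ⊏? x))
... | yes (x , Tx , t⊏x) = extremal _⊏?_ T? (rs t⊏x) Tx
... | no none = t , Tt , λ x Tx t⊏x → none (x , Tx , t⊏x)

indicator : Subset n → Chain n
indicator σ τ = eqᵇ τ σ

module Spheres (P : FinPoset n) where
  open FinPoset P
  open IsPartialOrder isPartialOrder using () renaming (refl to ≤-refl; antisym to ≤-antisym; trans to ≤-trans)
  open Complex P

  -- Maximal chains and low-dimensional spheres

  Comparable : Fin n → Subset n → Set
  Comparable x σ = ∀ t → t ∈ σ → (x ≤ t) ⊎ (t ≤ x)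

  MaxChain : Pred (Fin n) 0ℓ → Subset n → Set
  MaxChain X σ = IsChainIn P X σ × (∀ x → X x → Comparable x σ → x ∈ σ)

  module _ {X : Pred (Fin n) 0ℓ} where

    chain-∪ : ∀ {σ x} → IsChainIn P X σ → X x → Comparable x σ → IsChainIn P X (σ ∪ ⁅ x ⁆)
    chain-∪ {σ} {x} (σ⊆X , total) Xx cmp = ⊆X , total′
      where
      ⊆X : ∀ y → y ∈ σ ∪ ⁅ x ⁆ → X y
      ⊆X y y∈ with ∈-∪⁅⁆ σ x y∈
      ... | inj₁ y∈σ  = σ⊆X y y∈σ
      ... | inj₂ refl = Xx
      total′ : ∀ y z → y ∈ σ ∪ ⁅ x ⁆ → z ∈ σ ∪ ⁅ x ⁆ → (y ≤ z) ⊎ (z ≤ y)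
      total′ y z y∈ z∈ with ∈-∪⁅⁆ σ x y∈ | ∈-∪⁅⁆ σ x z∈
      ... | inj₁ y∈σ  | inj₁ z∈σ  = total y z y∈σ z∈σ
      ... | inj₁ y∈σ  | inj₂ refl = Sum.swap (cmp y y∈σ)
      ... | inj₂ refl | inj₁ z∈σ  = cmp z z∈σ
      ... | inj₂ refl | inj₂ refl = inj₁ ≤-refl

    chain-∪⁻ : ∀ {σ x} → IsChainIn P X (σ ∪ ⁅ x ⁆) → X x × Comparable x σ
    chain-∪⁻ {σ} {x} (⊆X , total) = ⊆X x (x∈σ∪x σ x) , λ t t∈ → total x t (x∈σ∪x σ x) (p⊆p∪q ⁅ x ⁆ t∈)

    chain-⊥ : IsChainIn P X Subset.⊥
    chain-⊥ = (λ x x∈ → ⊥-elim (∉⊥ x∈)) , λ x y x∈ → ⊥-elim (∉⊥ x∈)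

    chain-⁅⁆ : ∀ {x} → X x → IsChainIn P X ⁅ x ⁆
    chain-⁅⁆ {x} Xx = subst (IsChainIn P X) (∪-identityˡ ⁅ x ⁆) (chain-∪ chain-⊥ Xx λ t t∈ → ⊥-elim (∉⊥ t∈))

    -- A face in a boundary extends by a point to a larger chain, which a maximal chain does not.
    maxChain-nonbounding : ∀ {σ c} → MaxChain X σ → c σ ≡ true → ¬ Boundary P X ∣ σ ∣ c
    maxChain-nonbounding {σ} (_ , max) cσ (b , B , δb) with δ-true {b} (trans (δb σ) cσ)
    ... | x , x∉σ , bσx with Xx , cmp ← chain-∪⁻ (proj₁ (B _ bσx)) = x∉σ (max x Xx cmp)

    support : ∀ {d} → (sphere : HomologySphere P X d) →
      ∃ λ σ → proj₁ (proj₁ sphere) σ ≡ true × IsChainIn P X σ × ∣ σ ∣ ≡ d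
    support ((z , (Z , _) , z≁0 , _) , _) with anySubset? (λ σ → z σ Bool.≟ true)
    ... | yes (σ , zσ) = σ , zσ , Z σ zσ
    ... | no none = contradiction (0c , supp-0 , eq) z≁0
      where
      eq : δ 0c ≗ z
      eq σ with z σ in zσ
      ... | false = δ-0 σ
      ... | true  = contradiction (σ , zσ) none

    sphere-unique : ∀ {d d′} → HomologySphere P X d → HomologySphere P X d′ → d ≡ d′
    sphere-unique {d} {d′} ((z , cyc , z≁0 , _) , _) (_ , acyclic) with d ℕ.≟ d′
    ... | yes d≡d′ = d≡d′
    ... | no d≢d′ = contradiction (acyclic d d≢d′ z cyc) z≁0

    empty-sphere : ∀ {d} → (∀ x → ¬ X x) → HomologySphere P X d → d ≡ 0
    empty-sphere {zero} _ _ = refl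
    empty-sphere {suc d} empty sphere with σ , _ , (σ⊆X , _) , card ← support sphere
      with x , x∈σ ← ∣σ∣≡1+k⇒nonempty card = contradiction (σ⊆X x x∈σ) (empty x)

    δ-indicator-∪ : ∀ σ x → x ∉ σ → δ (indicator (σ ∪ ⁅ x ⁆)) σ ≡ true
    δ-indicator-∪ σ x x∉σ = trans (δ-sum b σ) (sum-unique (face b σ) x
      (trans (face-∉ b x∉σ) (eqᵇ-refl (σ ∪ ⁅ x ⁆))) unique)
      where
      b = indicator (σ ∪ ⁅ x ⁆)
      unique : ∀ y → face b σ y ≡ true → y ≡ x
      unique y eq with y∉σ , σy≡σx ← face-true b {σ} eq
        with ∈-∪⁅⁆ σ x (subst (y ∈_) (eqᵇ⇒≡ (σ ∪ ⁅ y ⁆) (σ ∪ ⁅ x ⁆) σy≡σx) (x∈σ∪x σ y))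
      ... | inj₁ y∈σ = contradiction y∈σ y∉σ
      ... | inj₂ y≡x = y≡x

    -- In size zero the fundamental class is the empty chain, which is the boundary of any point.
    nonempty-sphere : ∀ {d x} → X x → HomologySphere P X d → d ≢ 0
    nonempty-sphere {x = x} Xx sphere@((z , (Z , _) , z≁0 , _) , _) refl = z≁0 (indicator ⁅ x ⁆ , B , eq)
      where
      B : Supported P X 1 (indicator ⁅ x ⁆)
      B σ σ≡x with refl ← eqᵇ⇒≡ σ ⁅ x ⁆ σ≡x = chain-⁅⁆ Xx , ∣⁅x⁆∣≡1 x
      z⊥ : z Subset.⊥ ≡ true
      z⊥ with σ , zσ , _ , card ← support sphere = subst (λ τ → z τ ≡ true) (∣σ∣≡0⇒σ≡⊥ card) zσ
      δ⊥ : δ (indicator ⁅ x ⁆) Subset.⊥ ≡ true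
      δ⊥ = trans (δ-cong (λ τ → cong (eqᵇ τ) (sym (∪-identityˡ ⁅ x ⁆))) Subset.⊥) (δ-indicator-∪ Subset.⊥ x ∉⊥)
      eq : δ (indicator ⁅ x ⁆) ≗ z
      eq σ = bool-ext
        (λ δσ → subst (λ τ → z τ ≡ true) (sym (∣σ∣≡0⇒σ≡⊥ (proj₂ (supp-δ B σ δσ)))) z⊥)
        (λ zσ → subst (λ τ → δ (indicator ⁅ x ⁆) τ ≡ true) (sym (∣σ∣≡0⇒σ≡⊥ (proj₂ (Z σ zσ)))) δ⊥)

    -- The cycle is the sum of the two points, obtained as the boundary of the pair. The points may
    -- be incomparable, but `δδ` holds for arbitrary functions on subsets.
    two-points : ∀ {x y} → X x → X y → x ≢ y → ∃ λ c → Cycle P X 1 c × c ⁅ x ⁆ ≡ true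
    two-points {x} {y} Xx Xy x≢y = δ b , (supp , δδ b) , δ-indicator-∪ ⁅ x ⁆ y y∉x
      where
      b = indicator (⁅ x ⁆ ∪ ⁅ y ⁆)
      y∉x : y ∉ ⁅ x ⁆
      y∉x y∈ = x≢y (sym (x∈⁅y⁆⇒x≡y x y∈))
      supp : Supported P X 1 (δ b)
      supp σ δσ with δ-true {b} δσ
      ... | w , w∉σ , σw≡xy with eqᵇ⇒≡ (σ ∪ ⁅ w ⁆) (⁅ x ⁆ ∪ ⁅ y ⁆) σw≡xy
      ...   | eq with ∣σ∣≡1⇒singleton {σ = σ} (ℕ.suc-injective (trans (sym (∣σ∪x∣ σ w w∉σ))
                        (trans (cong ∣_∣ eq) (trans (∣σ∪x∣ ⁅ x ⁆ y y∉x) (cong suc (∣⁅x⁆∣≡1 x))))))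
      ...     | v , refl with ∈-∪⁅⁆ ⁅ x ⁆ y (subst (v ∈_) eq (p⊆p∪q ⁅ w ⁆ (x∈⁅x⁆ v)))
      ...       | inj₂ refl = chain-⁅⁆ Xy , ∣⁅x⁆∣≡1 v
      ...       | inj₁ v∈x with refl ← x∈⁅y⁆⇒x≡y x v∈x = chain-⁅⁆ Xx , ∣⁅x⁆∣≡1 v

    -- An isolated point and any other point form a cycle that does not bound.
    singleton-pure : ∀ {d x} → MaxChain X ⁅ x ⁆ → HomologySphere P X d → d ≡ 1
    singleton-pure {zero} {x} (chain , _) sphere =
      contradiction refl (nonempty-sphere (proj₁ chain x (x∈⁅x⁆ x)) sphere)
    singleton-pure {suc zero} _ _ = refl
    singleton-pure {suc (suc d)} {x} max@(chain , _) sphere@(_ , acyclic)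
      -- Chains in the support have at least two elements and so supply a point other than `x`.
      with σ , _ , (σ⊆X , _) , card ← support sphere
      with Fin.any? (λ y → (y ∈? σ) ×-dec ¬? (x Fin.≟ y))
    ... | yes (y , y∈σ , x≢y)
      with c , cyc , cx ← two-points (proj₁ chain x (x∈⁅x⁆ x)) (σ⊆X y y∈σ) x≢y =
      contradiction (subst (λ m → Boundary P X m c) (sym (∣⁅x⁆∣≡1 x)) (acyclic 1 (λ ()) c cyc))
        (maxChain-nonbounding {c = c} max cx)
    ... | no none = contradiction
            (ℕ.≤-trans (ℕ.≤-reflexive (sym card)) (ℕ.≤-trans (p⊆q⇒∣p∣≤∣q∣ σ⊆x) (ℕ.≤-reflexive (∣⁅x⁆∣≡1 x))))
            λ { (ℕ.s≤s ()) }
      where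
      σ⊆x : ∀ {y} → y ∈ σ → y ∈ ⁅ x ⁆
      σ⊆x {y} y∈σ with x Fin.≟ y
      ... | yes refl = x∈⁅x⁆ x
      ... | no x≢y = contradiction (y , y∈σ , x≢y) none

    -- If `z` missed `x`, let `c` be the sum of `x` and a point of `z`. Both `c` and `c + z` contain
    -- the maximal chain `⁅ x ⁆`, so neither bounds.
    discrete-sphere : (sphere : HomologySphere P X 1) → (∀ {x} → X x → MaxChain X ⁅ x ⁆) →
      ∀ x → X x → proj₁ (proj₁ sphere) ⁅ x ⁆ ≡ true
    discrete-sphere sphere@((z , (Z , _) , _ , 0∨z) , _) discrete x Xx with z ⁅ x ⁆ in zx
    ... | true  = refl
    ... | false with σ , zσ , (σ⊆X , _) , card ← support sphere
      with y , refl ← ∣σ∣≡1⇒singleton {σ = σ} card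
      with c , cyc , cx ← two-points Xx (σ⊆X y (x∈⁅x⁆ y)) (λ { refl → contradiction (trans (sym zx) zσ) λ () })
      with 0∨z c cyc
    ... | inj₁ bc  = ⊥-elim (maxChain-nonbounding {c = c} (discrete Xx) cx (subst (λ m → Boundary P X m c) (sym (∣⁅x⁆∣≡1 x)) bc))
    ... | inj₂ bcz = ⊥-elim (maxChain-nonbounding {c = c + z} (discrete Xx) (cong₂ _xor_ cx zx)
                       (subst (λ m → Boundary P X m (c + z)) (sym (∣⁅x⁆∣≡1 x)) bcz))

    -- The parity of the number of points in the cycle is the value of its boundary at the empty
    -- chain.
    sphere-even : ∀ (sphere : HomologySphere P X 1) → sum (λ x → proj₁ (proj₁ sphere) ⁅ x ⁆) ≡ false
    sphere-even ((z , (_ , δz) , _) , _) = begin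
      sum (λ x → z ⁅ x ⁆)       ≡⟨ sum-cong-≗ (λ x → trans (cong z (sym (∪-identityˡ ⁅ x ⁆))) (sym (face-∉ z ∉⊥))) ⟩
      sum (face z Subset.⊥)     ≡⟨ δ-sum z Subset.⊥ ⟨
      δ z Subset.⊥              ≡⟨ δz Subset.⊥ ⟩
      false                     ∎
      where open ≡-Reasoning

    module _ (_≤?_ : ∀ x y → Dec (x ≤ y)) (X? : Decidable X) where

      comparable? : ∀ x σ → Dec (Comparable x σ)
      comparable? x σ = Fin.all? λ t → (t ∈? σ) →-dec ((x ≤? t) ⊎-dec (t ≤? x))

      maxChain? : ∀ σ → Dec (MaxChain X σ)
      maxChain? σ =
        ((Fin.all? λ x → (x ∈? σ) →-dec X? x) ×-dec
         (map′ (λ f x y x∈ y∈ → f x x∈ y y∈) (λ f x x∈ y y∈ → f x y x∈ y∈)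
           (Fin.all? λ x → (x ∈? σ) →-dec comparable? x σ)))
        ×-dec (Fin.all? λ x → X? x →-dec (comparable? x σ →-dec (x ∈? σ)))

      extend : ∀ {σ} → IsChainIn P X σ → ∃ λ τ → (∀ x → x ∈ σ → x ∈ τ) × MaxChain X τ
      extend {σ} = go (suc n) (ℕ.s≤s (ℕ.m≤m+n n ∣ σ ∣))
        where
        -- The bound `n < k + ∣ σ ∣` is preserved by adjoining a point and is absurd at `k = 0`.
        go : ∀ k {σ} → n ℕ.< k ℕ.+ ∣ σ ∣ → IsChainIn P X σ → ∃ λ τ → (∀ x → x ∈ σ → x ∈ τ) × MaxChain X τ
        go zero    {σ} n<∣σ∣ _ = contradiction (∣p∣≤n σ) (ℕ.<⇒≱ n<∣σ∣)
        go (suc k) {σ} n<k chain with Fin.any? (λ x → X? x ×-dec (comparable? x σ ×-dec ¬? (x ∈? σ)))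
        ... | yes (x , Xx , cmp , x∉σ)
          with τ , σx⊆τ , max ← go k
                 (subst (n ℕ.<_) (trans (sym (ℕ.+-suc k ∣ σ ∣)) (cong (k ℕ.+_) (sym (∣σ∪x∣ σ x x∉σ)))) n<k)
                 (chain-∪ chain Xx cmp)
          = τ , (λ y y∈σ → σx⊆τ y (p⊆p∪q ⁅ x ⁆ y∈σ)) , max
        ... | no none = σ , (λ _ x∈ → x∈) , chain ,
          λ x Xx cmp → decidable-stable (x ∈? σ) λ x∉σ → none (x , Xx , cmp , x∉σ)

  -- Gaps in maximal chains and purity

  _⊏_ : Rel (Fin n) 0ℓ
  _⊏_ = _<_ P

  ⊏-≤-trans : ∀ {x y z} → x ⊏ y → y ≤ z → x ⊏ z
  ⊏-≤-trans (x≤y , x≢y) y≤z = ≤-trans x≤y y≤z , λ { refl → x≢y (≤-antisym x≤y y≤z) }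

  ≤-⊏-trans : ∀ {x y z} → x ≤ y → y ⊏ z → x ⊏ z
  ≤-⊏-trans x≤y (y≤z , y≢z) = ≤-trans x≤y y≤z , λ { refl → y≢z (≤-antisym y≤z x≤y) }

  ⊏-trans : ∀ {x y z} → x ⊏ y → y ⊏ z → x ⊏ z
  ⊏-trans x⊏y y⊏z = ⊏-≤-trans x⊏y (proj₁ y⊏z)

  ⊏⇒≱ : ∀ {x y} → x ⊏ y → ¬ (y ≤ x)
  ⊏⇒≱ (x≤y , x≢y) y≤x = x≢y (≤-antisym x≤y y≤x)

  compare : ∀ {x y} → (x ≤ y) ⊎ (y ≤ x) → (x ≤ y) ⊎ (y ⊏ x)
  compare {x} {y} (inj₁ x≤y) = inj₁ x≤y
  compare {x} {y} (inj₂ y≤x) with y Fin.≟ x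
  ... | yes refl = inj₁ ≤-refl
  ... | no y≢x   = inj₂ (y≤x , y≢x)

  module _ (S : Pred (Fin n) 0ℓ) (S? : Decidable S) (_≤?_ : ∀ x y → Dec (x ≤ y)) where

    private
      I = OpenInterval P S

    _⊏?_ : ∀ x y → Dec (x ⊏ y)
    x ⊏? y = (x ≤? y) ×-dec ¬? (x Fin.≟ y)

    I? : ∀ p q → Decidable (I p q)
    I? p q x = S? x ×-dec ((p ⊏? x) ×-dec (x ⊏? q))

    Pure : Fin n → Fin n → Set
    Pure p q = ∀ {d σ} → HomologySphere P (I p q) d → MaxChain (I p q) σ → ∣ σ ∣ ≡ d

    -- The gap (a,b) of the chain ρ in (p,q) consists of the points completing ρ to a maximal chain.
    module Gap {p q} (Sp : S p) (Sq : S q) {ρ x₀} (x₀∉ρ : x₀ ∉ ρ) (max : MaxChain (I p q) (ρ ∪ ⁅ x₀ ⁆)) where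

      private
        ρ⊆I : ∀ {t} → t ∈ ρ → I p q t
        ρ⊆I t∈ = proj₁ (proj₁ max) _ (p⊆p∪q ⁅ x₀ ⁆ t∈)

        Ix₀ : I p q x₀
        Ix₀ = proj₁ (chain-∪⁻ (proj₁ max))

        x₀-comparable : Comparable x₀ ρ
        x₀-comparable = proj₂ (chain-∪⁻ (proj₁ max))

        ρ-total : ∀ {s t} → s ∈ ρ → t ∈ ρ → (s ≤ t) ⊎ (t ≤ s)
        ρ-total s∈ t∈ = proj₂ (proj₁ max) _ _ (p⊆p∪q ⁅ x₀ ⁆ s∈) (p⊆p∪q ⁅ x₀ ⁆ t∈)

        Below Above : Pred (Fin n) 0ℓ
        Below t = (t ≡ p ⊎ t ∈ ρ) × (t ⊏ x₀)
        Above t = (t ≡ q ⊎ t ∈ ρ) × (x₀ ⊏ t)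

        -- Together with `p` and `q`, `ρ` is still a chain, so these extremal elements are the
        -- neighbours of `x₀`.
        lower : ∃ λ a → Below a × (∀ t → Below t → ¬ (a ⊏ t))
        lower = extremal _⊏?_ (λ t → ((t Fin.≟ p) ⊎-dec (t ∈? ρ)) ×-dec (t ⊏? x₀))
          (po-noetherian isPartialOrder p) (inj₁ refl , proj₁ (proj₂ Ix₀))

        upper : ∃ λ b → Above b × (∀ t → Above t → ¬ (t ⊏ b))
        upper = extremal (flip _⊏?_) (λ t → ((t Fin.≟ q) ⊎-dec (t ∈? ρ)) ×-dec (x₀ ⊏? t))
          (po-wellFounded isPartialOrder q) (inj₁ refl , proj₂ (proj₂ Ix₀))

      a b : Fin n
      a = proj₁ lower
      b = proj₁ upper

      a⊏x₀ : a ⊏ x₀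
      a⊏x₀ = proj₂ (proj₁ (proj₂ lower))

      x₀⊏b : x₀ ⊏ b
      x₀⊏b = proj₂ (proj₁ (proj₂ upper))

      a⊏b : a ⊏ b
      a⊏b = ⊏-trans a⊏x₀ x₀⊏b

      p≤a : p ≤ a
      p≤a with proj₁ (proj₁ (proj₂ lower))
      ... | inj₁ a≡p = subst (p ≤_) (sym a≡p) ≤-refl
      ... | inj₂ a∈ρ = proj₁ (proj₁ (proj₂ (ρ⊆I a∈ρ)))

      b≤q : b ≤ q
      b≤q with proj₁ (proj₁ (proj₂ upper))
      ... | inj₁ b≡q = subst (_≤ q) (sym b≡q) ≤-refl
      ... | inj₂ b∈ρ = proj₁ (proj₂ (proj₂ (ρ⊆I b∈ρ)))

      Sa : S a
      Sa with proj₁ (proj₁ (proj₂ lower))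
      ... | inj₁ a≡p = subst S (sym a≡p) Sp
      ... | inj₂ a∈ρ = proj₁ (ρ⊆I a∈ρ)

      Sb : S b
      Sb with proj₁ (proj₁ (proj₂ upper))
      ... | inj₁ b≡q = subst S (sym b≡q) Sq
      ... | inj₂ b∈ρ = proj₁ (ρ⊆I b∈ρ)

      compare-a : ∀ {y} → I p q y → Comparable y ρ → (y ≤ a) ⊎ (a ⊏ y)
      compare-a {y} Iy cmp with proj₁ (proj₁ (proj₂ lower))
      ... | inj₁ a≡p = inj₂ (subst (_⊏ y) (sym a≡p) (proj₁ (proj₂ Iy)))
      ... | inj₂ a∈ρ = compare (cmp a a∈ρ)

      compare-b : ∀ {y} → I p q y → Comparable y ρ → (b ≤ y) ⊎ (y ⊏ b)
      compare-b {y} Iy cmp with proj₁ (proj₁ (proj₂ upper))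
      ... | inj₁ b≡q = inj₂ (subst (y ⊏_) (sym b≡q) (proj₂ (proj₂ Iy)))
      ... | inj₂ b∈ρ = compare (Sum.swap (cmp b b∈ρ))

      outside-gap : ∀ {t} → t ∈ ρ → (t ≤ a) ⊎ (b ≤ t)
      outside-gap {t} t∈ρ with compare (x₀-comparable t t∈ρ)
      ... | inj₂ t⊏x₀ with compare-a (ρ⊆I t∈ρ) (λ s s∈ρ → ρ-total t∈ρ s∈ρ)
      ...   | inj₁ t≤a = inj₁ t≤a
      ...   | inj₂ a⊏t = contradiction a⊏t (proj₂ (proj₂ lower) t (inj₂ t∈ρ , t⊏x₀))
      outside-gap {t} t∈ρ | inj₁ x₀≤t with compare-b (ρ⊆I t∈ρ) (λ s s∈ρ → ρ-total t∈ρ s∈ρ)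
      ... | inj₁ b≤t = inj₂ b≤t
      ... | inj₂ t⊏b = contradiction t⊏b (proj₂ (proj₂ upper) t (inj₂ t∈ρ , x₀≤t , λ { refl → x₀∉ρ t∈ρ }))

      -- A point of `ρ` separates the gap from one end of `(p,q)`, so the induction hypothesis
      -- covers the gap.
      proper : Nonempty ρ → (p ⊏ a) ⊎ (b ⊏ q)
      proper (t , t∈ρ) with outside-gap t∈ρ
      ... | inj₁ t≤a = inj₁ (⊏-≤-trans (proj₁ (proj₂ (ρ⊆I t∈ρ))) t≤a)
      ... | inj₂ b≤t = inj₂ (≤-⊏-trans b≤t (proj₂ (proj₂ (ρ⊆I t∈ρ))))

      gap-∉ : ∀ {y} → I a b y → y ∉ ρ
      gap-∉ (_ , a⊏y , y⊏b) y∈ρ with outside-gap y∈ρ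
      ... | inj₁ y≤a = ⊏⇒≱ a⊏y y≤a
      ... | inj₂ b≤y = ⊏⇒≱ y⊏b b≤y

      gap⊆I : ∀ {y} → I a b y → I p q y
      gap⊆I (Sy , a⊏y , y⊏b) = Sy , ≤-⊏-trans p≤a a⊏y , ⊏-≤-trans y⊏b b≤q

      gap-comparable : ∀ {y} → I a b y → Comparable y ρ
      gap-comparable (_ , a⊏y , y⊏b) t t∈ρ with outside-gap t∈ρ
      ... | inj₁ t≤a = inj₂ (≤-trans t≤a (proj₁ a⊏y))
      ... | inj₂ b≤t = inj₁ (≤-trans (proj₁ y⊏b) b≤t)

      -- A point outside the gap is comparable with `x₀` through `a` or `b`, and maximality of
      -- `ρ ∪ ⁅ x₀ ⁆` then captures it.
      comparable⇒∈∨gap : ∀ {y} → I p q y → Comparable y ρ → y ∈ ρ ⊎ I a b y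
      comparable⇒∈∨gap {y} Iy cmp = cases (compare-a Iy cmp) (compare-b Iy cmp)
        where
        ∈ρ : (y ≤ x₀) ⊎ (x₀ ≤ y) → y ≢ x₀ → y ∈ ρ
        ∈ρ y~x₀ y≢x₀ with ∈-∪⁅⁆ ρ x₀ (proj₂ max y Iy λ t t∈ → [ cmp t , (λ { refl → y~x₀ }) ]′ (∈-∪⁅⁆ ρ x₀ t∈))
        ... | inj₁ y∈ρ  = y∈ρ
        ... | inj₂ y≡x₀ = contradiction y≡x₀ y≢x₀
        cases : (y ≤ a) ⊎ (a ⊏ y) → (b ≤ y) ⊎ (y ⊏ b) → y ∈ ρ ⊎ I a b y
        cases (inj₂ a⊏y) (inj₂ y⊏b) = inj₂ (proj₁ Iy , a⊏y , y⊏b)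
        cases (inj₁ y≤a) _          = inj₁ (∈ρ (inj₁ (≤-trans y≤a (proj₁ a⊏x₀))) λ { refl → ⊏⇒≱ a⊏x₀ y≤a })
        cases (inj₂ _)   (inj₁ b≤y) = inj₁ (∈ρ (inj₂ (≤-trans (proj₁ x₀⊏b) b≤y)) λ { refl → ⊏⇒≱ x₀⊏b b≤y })

      x₀-maximal : MaxChain (I a b) ⁅ x₀ ⁆
      x₀-maximal = chain-⁅⁆ (proj₁ Ix₀ , a⊏x₀ , x₀⊏b) , λ y Iy cmp →
        [ (λ y∈ρ → contradiction y∈ρ (gap-∉ Iy)) , (λ { refl → x∈⁅x⁆ x₀ }) ]′
          (∈-∪⁅⁆ ρ x₀ (proj₂ max y (gap⊆I Iy) λ t t∈ →
            [ gap-comparable Iy t , (λ { refl → cmp x₀ (x∈⁅x⁆ x₀) }) ]′ (∈-∪⁅⁆ ρ x₀ t∈)))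

      completion⇒gap : ∀ {x} → x ∉ ρ → MaxChain (I p q) (ρ ∪ ⁅ x ⁆) → I a b x
      completion⇒gap x∉ρ (chain , _) with Ix , cmp ← chain-∪⁻ chain =
        [ (λ x∈ρ → contradiction x∈ρ x∉ρ) , id ]′ (comparable⇒∈∨gap Ix cmp)

      gap⇒completion : ∀ {x} → MaxChain (I a b) ⁅ x ⁆ → MaxChain (I p q) (ρ ∪ ⁅ x ⁆)
      gap⇒completion {x} (x-chain , x-max) =
        chain-∪ (⊆-chain (λ t → p⊆p∪q ⁅ x₀ ⁆) (proj₁ max)) (gap⊆I Ix) (gap-comparable Ix) , λ y Iy cmp →
        [ p⊆p∪q ⁅ x ⁆ ,
          (λ y∈gap → q⊆p∪q ρ ⁅ x ⁆ (x-max y y∈gap λ t t∈ → cmp t (q⊆p∪q ρ ⁅ x ⁆ t∈))) ]′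
        (comparable⇒∈∨gap Iy λ t t∈ → cmp t (p⊆p∪q ⁅ x ⁆ t∈))
        where
        Ix : I a b x
        Ix = proj₁ x-chain x (x∈⁅x⁆ x)

    module _ (spheres : ∀ {p q} → S p → S q → p ⊏ q → ∃ (HomologySphere P (I p q))) where

      -- A chain one short of maximal is completed by the points of its gap, of which there are
      -- evenly many, since the gap is a 0-sphere; so the maximal chains of a given size sum to a cycle.
      pure-step : ∀ {p q} → S p → S q →
        (∀ {a b} → p ≤ a → b ≤ q → (p ⊏ a) ⊎ (b ⊏ q) → S a → S b → a ⊏ b → Pure a b) → Pure p q
      pure-step {p} {q} Sp Sq ih {d} {σ} sphere max@(chain , maximal) with ∣ σ ∣ in card
      ... | zero = sym (empty-sphere (λ x Ix → ∈⇒∣∣≢0 (maximal x Ix λ t t∈ → contradiction card (∈⇒∣∣≢0 t∈)) card) sphere)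
      ... | suc zero with x , refl ← ∣σ∣≡1⇒singleton {σ = σ} card = sym (singleton-pure max sphere)
      -- With at least two elements, deleting one leaves a nonempty `ρ`, so its gap is a proper
      -- subinterval.
      ... | suc (suc k) with d ℕ.≟ suc (suc k)
      ...   | yes d≡k = sym d≡k
      ...   | no d≢k = contradiction
                (subst (λ m → Boundary P (I p q) m c) (sym card) (proj₂ sphere (suc (suc k)) (d≢k ∘ sym) c (C , δc)))
                (maxChain-nonbounding {c = c} max (dec-true (member? σ) (max , card)))
        where
        member? : ∀ τ → Dec (MaxChain (I p q) τ × ∣ τ ∣ ≡ suc (suc k))
        member? τ = maxChain? _≤?_ (I? p q) τ ×-dec (∣ τ ∣ ℕ.≟ suc (suc k))

        c : Chain n
        c τ = does (member? τ)

        C : Supported P (I p q) (suc (suc k)) c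
        C τ cτ with (τ-chain , _) , τ-card ← does-true (member? τ) cτ = τ-chain , τ-card

        module _ {ρ x₀} (x₀∉ρ : x₀ ∉ ρ) (member : MaxChain (I p q) (ρ ∪ ⁅ x₀ ⁆) × ∣ ρ ∪ ⁅ x₀ ⁆ ∣ ≡ suc (suc k)) where
          open Gap Sp Sq x₀∉ρ (proj₁ member)

          ∣ρ∣ : ∣ ρ ∣ ≡ suc k
          ∣ρ∣ = ℕ.suc-injective (trans (sym (∣σ∪x∣ ρ x₀ x₀∉ρ)) (proj₂ member))

          gap-pure : Pure a b
          gap-pure = ih p≤a b≤q (proper (∣σ∣≡1+k⇒nonempty ∣ρ∣)) Sa Sb a⊏b

          -- `⁅ x₀ ⁆` is a maximal chain of the gap, which fixes the dimension of the sphere.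
          gap-sphere : ∃ (HomologySphere P (I a b)) → HomologySphere P (I a b) 1
          gap-sphere (e , sphere) = subst (HomologySphere P (I a b)) (singleton-pure x₀-maximal sphere) sphere

          -- By purity of the gap, a maximal chain through a point is that point alone.
          gap-discrete : HomologySphere P (I a b) 1 → ∀ {x} → I a b x → MaxChain (I a b) ⁅ x ⁆
          gap-discrete sphere {x} Ix
            with τ , x⊆τ , τ-max ← extend _≤?_ (I? a b) (chain-⁅⁆ Ix)
            with y , refl ← ∣σ∣≡1⇒singleton {σ = τ} (gap-pure sphere τ-max)
            with refl ← x∈⁅y⁆⇒x≡y y (x⊆τ x (x∈⁅x⁆ x)) = τ-max

          δcρ : HomologySphere P (I a b) 1 → δ c ρ ≡ false
          δcρ sphere = begin
            δ c ρ                                       ≡⟨ δ-sum c ρ ⟩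
            sum (face c ρ)                              ≡⟨ sum-cong-≗ faces ⟩
            sum (λ x → proj₁ (proj₁ sphere) ⁅ x ⁆)      ≡⟨ sphere-even sphere ⟩
            false                                       ∎
            where
            open ≡-Reasoning
            faces : ∀ x → face c ρ x ≡ proj₁ (proj₁ sphere) ⁅ x ⁆
            faces x = bool-ext to from
              where
              to : face c ρ x ≡ true → proj₁ (proj₁ sphere) ⁅ x ⁆ ≡ true
              to fx with x∉ρ , cρx ← face-true c {ρ} fx =
                discrete-sphere sphere (gap-discrete sphere) x
                  (completion⇒gap x∉ρ (proj₁ (does-true (member? (ρ ∪ ⁅ x ⁆)) cρx)))
              from : proj₁ (proj₁ sphere) ⁅ x ⁆ ≡ true → face c ρ x ≡ true
              from zx = trans (face-∉ c x∉ρ) (dec-true (member? (ρ ∪ ⁅ x ⁆))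
                (gap⇒completion (gap-discrete sphere Ix) , trans (∣σ∪x∣ ρ x x∉ρ) (cong suc ∣ρ∣)))
                where
                Ix : I a b x
                Ix = proj₁ (proj₁ (proj₁ (proj₁ (proj₂ (proj₁ sphere))) ⁅ x ⁆ zx)) x (x∈⁅x⁆ x)
                x∉ρ = gap-∉ Ix

          gap-cycle : δ c ρ ≡ false
          gap-cycle = δcρ (gap-sphere (spheres Sa Sb a⊏b))

        δc : ∀ ρ → δ c ρ ≡ false
        δc ρ with δ c ρ in eq
        ... | false = refl
        ... | true with x₀ , x₀∉ρ , cρx₀ ← δ-true {c} eq =
          trans (sym eq) (gap-cycle x₀∉ρ (does-true (member? (ρ ∪ ⁅ x₀ ⁆)) cρx₀))

      pure : ∀ {p q} → S p → S q → p ⊏ q → Pure p q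
      pure {p} {q} Sp Sq p⊏q = go (po-noetherian isPartialOrder p) (po-wellFounded isPartialOrder q) Sp Sq p⊏q
        where
        -- A smaller interval raises `p` or lowers `q`, hence recursion on both accessibility
        -- proofs.
        go : ∀ {p q} → Acc (flip _⊏_) p → Acc _⊏_ q → S p → S q → p ⊏ q → Pure p q
        go {p} {q} (acc above) (acc below) Sp Sq _ = pure-step Sp Sq smaller
          where
          smaller : ∀ {a b} → p ≤ a → b ≤ q → (p ⊏ a) ⊎ (b ⊏ q) → S a → S b → a ⊏ b → Pure a b
          smaller {a} {b} p≤a b≤q _ Sa Sb a⊏b with p Fin.≟ a | b Fin.≟ q
          ... | no p≢a   | yes refl = go (above (p≤a , p≢a)) (acc below) Sa Sb a⊏b
          ... | no p≢a   | no b≢q   = go (above (p≤a , p≢a)) (below (b≤q , b≢q)) Sa Sb a⊏b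
          ... | yes refl | no b≢q   = go (acc above) (below (b≤q , b≢q)) Sa Sb a⊏b
          smaller _ _ (inj₁ p⊏a) _ _ _ | yes p≡a | yes _ = contradiction p≡a (proj₂ p⊏a)
          smaller _ _ (inj₂ b⊏q) _ _ _ | yes _ | yes b≡q = contradiction b≡q (proj₂ b⊏q)

      -- A point comparable with the joined chain is comparable with `r`, so it lies on one side of
      -- `r`, where `σ` or `τ` is maximal.
      join-maximal : ∀ {p r q σ τ} → S r → p ⊏ r → r ⊏ q → MaxChain (I p r) σ → MaxChain (I r q) τ →
        MaxChain (I p q) ((σ ∪ ⁅ r ⁆) ∪ τ) × ∣ (σ ∪ ⁅ r ⁆) ∪ τ ∣ ≡ suc (∣ σ ∣ ℕ.+ ∣ τ ∣)
      join-maximal {p} {r} {q} {σ} {τ} Sr p⊏r r⊏q ((σ⊆I , σ-total) , σ-max) ((τ⊆I , τ-total) , τ-max) =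
        ((⊆I , total) , maximal) ,
        trans (∣σ∪τ∣ (σ ∪ ⁅ r ⁆) τ disjoint) (cong (ℕ._+ ∣ τ ∣) (∣σ∪x∣ σ r λ r∈σ → ⊏⇒≱ (σ⊏r r∈σ) ≤-refl))
        where
        σ⊏r : ∀ {x} → x ∈ σ → x ⊏ r
        σ⊏r x∈σ = proj₂ (proj₂ (σ⊆I _ x∈σ))
        r⊏τ : ∀ {x} → x ∈ τ → r ⊏ x
        r⊏τ x∈τ = proj₁ (proj₂ (τ⊆I _ x∈τ))
        cases : ∀ x → x ∈ (σ ∪ ⁅ r ⁆) ∪ τ → x ∈ σ ⊎ x ≡ r ⊎ x ∈ τ
        cases x x∈ with x∈p∪q⁻ (σ ∪ ⁅ r ⁆) τ x∈
        ... | inj₁ x∈σr = Sum.map₂ inj₁ (∈-∪⁅⁆ σ r x∈σr)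
        ... | inj₂ x∈τ = inj₂ (inj₂ x∈τ)
        σ⇒ : ∀ {x} → x ∈ σ → x ∈ (σ ∪ ⁅ r ⁆) ∪ τ
        σ⇒ x∈σ = p⊆p∪q τ (p⊆p∪q ⁅ r ⁆ x∈σ)
        r⇒ : r ∈ (σ ∪ ⁅ r ⁆) ∪ τ
        r⇒ = p⊆p∪q τ (x∈σ∪x σ r)
        τ⇒ : ∀ {x} → x ∈ τ → x ∈ (σ ∪ ⁅ r ⁆) ∪ τ
        τ⇒ = q⊆p∪q (σ ∪ ⁅ r ⁆) τ
        disjoint : ∀ x → x ∈ σ ∪ ⁅ r ⁆ → x ∉ τ
        disjoint x x∈ x∈τ with ∈-∪⁅⁆ σ r x∈
        ... | inj₁ x∈σ  = ⊏⇒≱ (r⊏τ x∈τ) (proj₁ (σ⊏r x∈σ))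
        ... | inj₂ refl = ⊏⇒≱ (r⊏τ x∈τ) ≤-refl
        ⊆I : ∀ x → x ∈ (σ ∪ ⁅ r ⁆) ∪ τ → I p q x
        ⊆I x x∈ with cases x x∈
        ... | inj₁ x∈σ with Sx , p⊏x , x⊏r ← σ⊆I x x∈σ = Sx , p⊏x , ⊏-trans x⊏r r⊏q
        ... | inj₂ (inj₁ refl) = Sr , p⊏r , r⊏q
        ... | inj₂ (inj₂ x∈τ) with Sx , r⊏x , x⊏q ← τ⊆I x x∈τ = Sx , ⊏-trans p⊏r r⊏x , x⊏q
        total : ∀ x y → x ∈ (σ ∪ ⁅ r ⁆) ∪ τ → y ∈ (σ ∪ ⁅ r ⁆) ∪ τ → (x ≤ y) ⊎ (y ≤ x)
        total x y x∈ y∈ with cases x x∈ | cases y y∈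
        ... | inj₁ x∈σ         | inj₁ y∈σ         = σ-total x y x∈σ y∈σ
        ... | inj₁ x∈σ         | inj₂ (inj₁ refl) = inj₁ (proj₁ (σ⊏r x∈σ))
        ... | inj₁ x∈σ         | inj₂ (inj₂ y∈τ)  = inj₁ (≤-trans (proj₁ (σ⊏r x∈σ)) (proj₁ (r⊏τ y∈τ)))
        ... | inj₂ (inj₁ refl) | inj₁ y∈σ         = inj₂ (proj₁ (σ⊏r y∈σ))
        ... | inj₂ (inj₁ refl) | inj₂ (inj₁ refl) = inj₁ ≤-refl
        ... | inj₂ (inj₁ refl) | inj₂ (inj₂ y∈τ)  = inj₁ (proj₁ (r⊏τ y∈τ))
        ... | inj₂ (inj₂ x∈τ)  | inj₁ y∈σ         = inj₂ (≤-trans (proj₁ (σ⊏r y∈σ)) (proj₁ (r⊏τ x∈τ)))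
        ... | inj₂ (inj₂ x∈τ)  | inj₂ (inj₁ refl) = inj₂ (proj₁ (r⊏τ x∈τ))
        ... | inj₂ (inj₂ x∈τ)  | inj₂ (inj₂ y∈τ)  = τ-total x y x∈τ y∈τ
        maximal : ∀ x → I p q x → Comparable x ((σ ∪ ⁅ r ⁆) ∪ τ) → x ∈ (σ ∪ ⁅ r ⁆) ∪ τ
        maximal x (Sx , p⊏x , x⊏q) cmp with x Fin.≟ r | cmp r r⇒
        ... | yes refl | _ = r⇒
        ... | no x≢r | inj₁ x≤r = σ⇒ (σ-max x (Sx , p⊏x , x≤r , x≢r) λ t t∈ → cmp t (σ⇒ t∈))
        ... | no x≢r | inj₂ r≤x = τ⇒ (τ-max x (Sx , (r≤x , x≢r ∘ sym) , x⊏q) λ t t∈ → cmp t (τ⇒ t∈))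

      -- Purity turns all three dimensions into sizes of maximal chains; the `suc` counts the
      -- joining point `r`.
      sphere-additive′ : ∀ {p r q d e f} → S p → S r → S q → p ⊏ r → r ⊏ q →
        HomologySphere P (I p r) d → HomologySphere P (I r q) e → HomologySphere P (I p q) f →
        f ≡ suc (d ℕ.+ e)
      sphere-additive′ {p} {r} {q} Sp Sr Sq p⊏r r⊏q D E F
        with σ , _ , σ-max ← extend _≤?_ (I? p r) chain-⊥
        with τ , _ , τ-max ← extend _≤?_ (I? r q) chain-⊥
        with max , card ← join-maximal Sr p⊏r r⊏q σ-max τ-max =
        trans (sym (pure Sp Sq (⊏-trans p⊏r r⊏q) F max)) (trans card
          (cong₂ (λ d e → suc (d ℕ.+ e)) (pure Sp Sr p⊏r D σ-max) (pure Sr Sq r⊏q E τ-max)))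

  -- Finitely many instances of excluded middle can be combined under a double negation.
  ¬¬-decidable : ¬ ¬ (∀ x y → Dec (x ≤ y))
  ¬¬-decidable = Fin.sequence applicative λ x → Fin.sequence applicative λ y → ¬¬-excluded-middle
    where applicative = RawMonad.rawApplicative ¬¬-Monad

  -- The rank function

  module _ (S : Pred (Fin n) 0ℓ) (S? : Decidable S)
    (spheres : ∀ {p q} → S p → S q → p ⊏ q → ∃ (HomologySphere P (OpenInterval P S p q))) where

    -- An equation in ℕ is stable, so ≤ may be assumed decidable in its proof.
    sphere-additive : ∀ {p r q d e f} → S p → S r → S q → p ⊏ r → r ⊏ q →
      HomologySphere P (OpenInterval P S p r) d → HomologySphere P (OpenInterval P S r q) e →
      HomologySphere P (OpenInterval P S p q) f → f ≡ suc (d ℕ.+ e)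
    sphere-additive Sp Sr Sq p⊏r r⊏q D E F = decidable-stable (_ ℕ.≟ _)
      (¬¬-map (λ _≤?_ → sphere-additive′ S S? _≤?_ spheres Sp Sr Sq p⊏r r⊏q D E F) ¬¬-decidable)

    gorenstein : ∀ 0̂ 1̂ → S 0̂ → S 1̂ → (∀ x → S x → (0̂ ≤ x) × (x ≤ 1̂)) → GorensteinOn P S
    gorenstein 0̂ 1̂ S0 S1 bounds = 0̂ , 1̂ , S0 , S1 , bounds , rank , rank-0̂ , rank-cover , rank-sphere
      where
      -- A maximal chain of `(0̂,x)` has one element fewer than the rank of `x`, hence the `suc`.
      -- Outside `S` the value 0 is an arbitrary default.
      rank : Fin n → ℕ
      rank x with S? x | 0̂ Fin.≟ x
      ... | no _   | _       = 0
      ... | yes _  | yes _   = 0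
      ... | yes Sx | no 0̂≢x = suc (proj₁ (spheres S0 Sx (proj₁ (bounds x Sx) , 0̂≢x)))

      rank-0̂ : rank 0̂ ≡ 0
      rank-0̂ with S? 0̂ | 0̂ Fin.≟ 0̂
      ... | no _  | _        = refl
      ... | yes _ | yes _    = refl
      ... | yes _ | no 0̂≢0̂ = contradiction refl 0̂≢0̂

      rank-≢0̂ : ∀ {x d} → S x → 0̂ ≢ x → HomologySphere P (OpenInterval P S 0̂ x) d → rank x ≡ suc d
      rank-≢0̂ {x} Sx 0̂≢x sphere with S? x | 0̂ Fin.≟ x
      ... | no ¬Sx | _        = contradiction Sx ¬Sx
      ... | yes _  | yes 0̂≡x = contradiction 0̂≡x 0̂≢x
      ... | yes Sx′ | no 0̂≢x′ = cong suc (sphere-unique (proj₂ (spheres S0 Sx′ (proj₁ (bounds x Sx′) , 0̂≢x′))) sphere)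

      -- For `p` above `0̂` this is additivity along `0̂ ⊏ p ⊏ q`; for `p = 0̂` it is the definition
      -- of `rank`.
      rank-+ : ∀ {p q d} → S p → S q → p ⊏ q → HomologySphere P (OpenInterval P S p q) d → rank q ≡ suc (rank p ℕ.+ d)
      rank-+ {p} {q} {d} Sp Sq p⊏q sphere = by-cases (0̂ Fin.≟ p)
        where
        concat : 0̂ ⊏ p → ∃ (HomologySphere P (OpenInterval P S 0̂ p)) → ∃ (HomologySphere P (OpenInterval P S 0̂ q)) →
          rank q ≡ suc (rank p ℕ.+ d)
        concat 0̂⊏p (e , E) (f , F) = trans (rank-≢0̂ Sq (proj₂ (⊏-trans 0̂⊏p p⊏q)) F) (cong suc
          (trans (sphere-additive S0 Sp Sq 0̂⊏p p⊏q E sphere F) (cong (ℕ._+ d) (sym (rank-≢0̂ Sp (proj₂ 0̂⊏p) E)))))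
        by-cases : Dec (0̂ ≡ p) → rank q ≡ suc (rank p ℕ.+ d)
        by-cases (yes refl) = trans (rank-≢0̂ Sq (proj₂ p⊏q) sphere) (cong (λ m → suc (m ℕ.+ d)) (sym rank-0̂))
        by-cases (no 0̂≢p) = concat 0̂⊏p (spheres S0 Sp 0̂⊏p) (spheres S0 Sq (⊏-trans 0̂⊏p p⊏q))
          where
          0̂⊏p : 0̂ ⊏ p
          0̂⊏p = proj₁ (bounds p Sp) , 0̂≢p

      rank-cover : ∀ x y → S x → S y → CoversIn P S x y → rank y ≡ suc (rank x)
      rank-cover x y Sx Sy (x⊏y , gap) = cover (spheres Sx Sy x⊏y)
        where
        cover : ∃ (HomologySphere P (OpenInterval P S x y)) → rank y ≡ suc (rank x)
        cover (d , sphere) with refl ← empty-sphere (λ z (Sz , x⊏z , z⊏y) → gap z Sz x⊏z z⊏y) sphere =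
          trans (rank-+ Sx Sy x⊏y sphere) (cong suc (ℕ.+-identityʳ (rank x)))

      rank-sphere : ∀ p q → S p → S q → p ⊏ q → HomologySphere P (OpenInterval P S p q) (rank q ℕ.∸ rank p ℕ.∸ 1)
      rank-sphere p q Sp Sq p⊏q = relabel (spheres Sp Sq p⊏q)
        where
        relabel : ∃ (HomologySphere P (OpenInterval P S p q)) → HomologySphere P (OpenInterval P S p q) (rank q ℕ.∸ rank p ℕ.∸ 1)
        relabel (d , sphere) = subst (HomologySphere P (OpenInterval P S p q)) (sym eq) sphere
          where
          open ≡-Reasoning
          eq : rank q ℕ.∸ rank p ℕ.∸ 1 ≡ d
          eq = begin
            rank q ℕ.∸ rank p ℕ.∸ 1                 ≡⟨ cong (λ m → m ℕ.∸ rank p ℕ.∸ 1) (rank-+ Sp Sq p⊏q sphere) ⟩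
            suc (rank p ℕ.+ d) ℕ.∸ rank p ℕ.∸ 1     ≡⟨ cong (λ m → m ℕ.∸ rank p ℕ.∸ 1) (ℕ.+-suc (rank p) d) ⟨
            (rank p ℕ.+ suc d) ℕ.∸ rank p ℕ.∸ 1     ≡⟨ cong (ℕ._∸ 1) (ℕ.m+n∸m≡n (rank p) (suc d)) ⟩
            d                                       ∎

-- Intervals of the fixed-point poset

theorem3p4 : (n : ℕ) (P : FinPoset n) → Gorenstein* P →
    (ν : Fin n → Fin n) → IsOrderAutomorphism P ν → (∀ x → ν (ν x) ≡ x) →
    GorensteinOn P (FixedPoints ν)
theorem3p4 n P (0̂ , 1̂ , _ , _ , bounds , ρ , _ , _ , spheres) ν aut νν =
  gorenstein (FixedPoints ν) (λ x → ν x Fin.≟ x) fixed-spheres 0̂ 1̂ ν0̂≡0̂ ν1̂≡1̂ (λ x _ → bounds x tt)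
  where
  open FinPoset P
  open IsPartialOrder isPartialOrder using (antisym)
  open Spheres P

  ν-mono : ∀ {x y} → x ≤ y → ν x ≤ ν y
  ν-mono = Equivalence.to (aut _ _)

  -- Applying `ν` to `0̂ ≤ ν 0̂` gives the reverse inequality; dually for `1̂`.
  ν0̂≡0̂ : ν 0̂ ≡ 0̂
  ν0̂≡0̂ = antisym (subst (ν 0̂ ≤_) (νν 0̂) (ν-mono (proj₁ (bounds (ν 0̂) tt)))) (proj₁ (bounds (ν 0̂) tt))

  ν1̂≡1̂ : ν 1̂ ≡ 1̂
  ν1̂≡1̂ = antisym (proj₂ (bounds (ν 1̂) tt)) (subst (_≤ ν 1̂) (νν 1̂) (ν-mono (proj₂ (bounds (ν 1̂) tt))))

  ν-strict : ∀ {x y} → x ⊏ y → ν x ⊏ ν y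
  ν-strict {x} {y} (x≤y , x≢y) = ν-mono x≤y , λ νx≡νy → x≢y (trans (sym (νν x)) (trans (cong ν νx≡νy) (νν y)))

  fixed-spheres : ∀ {p q} → ν p ≡ p → ν q ≡ q → p ⊏ q → ∃ (HomologySphere P (OpenInterval P (FixedPoints ν) p q))
  fixed-spheres {p} {q} νp νq p⊏q = fixed-sphere (spheres p q tt tt p⊏q)
    where
    -- As `p` and `q` are fixed, `ν` maps the interval `(p,q)` of `P` to itself.
    open Smith P ν aut νν (OpenInterval P (λ _ → ⊤) p q) (OpenInterval P (FixedPoints ν) p q)
      (λ {x} (_ , p⊏x , x⊏q) → tt , subst (_⊏ ν x) νp (ν-strict p⊏x) , subst (ν x ⊏_) νq (ν-strict x⊏q))
      (λ (_ , p⊏x , x⊏q) → tt , p⊏x , x⊏q)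
      proj₁
      (λ νx (_ , p⊏x , x⊏q) → νx , p⊏x , x⊏q)
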